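{- Let $H$ be a finite $k$-graph, $v \in V(H)$, and fix a linear ordering $\prec$ of $V(H)$. Let $T(H,v)$ be the $k$-walk-tree of $H$ rooted at $v$ (with respect to $\prec$) and let $V$ be the one-vertex conflict-free walk $(v)$, a vertex of $T(H,v)$. Then $$\frac{m_k(H - v, x)}{m_k(H, x)} = \frac{m_k(T(H,v) - V, x)}{m_k(T(H,v), x)}.$$
   Context: A $k$-graph is a $k$-uniform hypergraph; deleting a vertex removes it and all edges containing it. For an $n$-vertex $k$-graph $H$, its matching polynomial is $m_k(H,x) = \sum_{i=0}^{\lfloor n/k\rfloor} (-1)^i p(H,i) x^{n-ki}$, where $p(H,i)$ is the number of matchings (sets of pairwise vertex-disjoint edges) of size $i$ in $H$, and $p(H,0)=1$. A Berge-path is a sequence $(v_0, e_1, v_1, \dots, e_\ell, v_\ell)$ of distinct vertices $v_0,\dots,v_\ell$ and distinct edges $e_1,\dots,e_\ell$ with $v_{i-1}, v_i \in e_i$ for each $i$. Given a linear ordering $\prec$ of $V(H)$, for such a Berge-path with $\ell \ge 1$ write $e_i = \{v_{i-1}, u_{(i,1)}, \dots, u_{(i,k-2)}, v_i\}$ and $C_i = \{u_{(i,j)} : u_{(i,j)} \prec v_i, j \in [k-2]\} \cup \{v_{i-1}\}$. The Berge-path is a conflict-free walk from $v_0$ to $v_\ell$ if for each $2 \le i \le \ell$ the edge $e_i$ is disjoint from $\bigcup_{j=1}^{i-1} C_j$; also each one-vertex sequence $(v)$ is a conflict-free walk from $v$ to $v$. The $k$-walk-tree $T(H,v)$ is the $k$-graph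 whose vertices are the conflict-free walks starting at $v$, where $k$ such walks $W_0, W_1, \dots, W_{k-1}$ form an edge whenever there is an edge $e = \{u_0, \dots, u_{k-1}\} \in E(H)$ such that $W_0$ ends at $u_0$ and, for each $i \in [k-1]$, $W_i$ is the walk obtained from $W_0$ by appending $e$ and then $u_i$ (so $W_i$ ends at $u_i$). -}

module Defs where

open import Data.Bool using (Bool; true; false; _∧_; _∨_; if_then_else_; not)
open import Data.Nat as ℕ using (ℕ; zero; suc; _+_; _*_; _∸_; _<_; _≡ᵇ_)
open import Data.Integer as ℤ using (ℤ; +_)
open import Data.Fin as Fin using (Fin)
open import Data.Fin.Subset using (Subset; _∈_; _∪_; ⁅_⁆; ⊥)
open import Data.Fin.Subset.Properties using (_∈?_)
open import Data.List using (List; []; _∷_; [_]; map; _++_; length; filterᵇ; concatMap; upTo; foldr; allFin)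
open import Data.List.Properties as LP using ()
open import Data.List.Relation.Unary.Unique.Propositional using (Unique)
open import Data.List.Membership.Propositional as LM using ()
open import Data.List.Membership.DecPropositional as DecMem using ()
open import Data.Product using (_×_; _,_; proj₁; proj₂)
open import Data.Product.Properties as PP using ()
open import Data.Vec as Vec using ()
open import Data.Vec.Properties as VP using ()
import Data.Bool.Properties as BP
open import Data.Bool.ListAction using (all; any)
open import Data.Unit using (⊤)
open import Data.Empty renaming (⊥ to Empty)
open import Relation.Nullary using (does; ¬_)
open import Relation.Binary.Definitions using (DecidableEquality)

-- Generic finite hypergraphs (vertex type with decidable equality,
-- a duplicate-free vertex list, and a list of edges, each edge given
-- as the list of its vertices).

record HGraph : Set₁ where
  field
    V      : Set
    decV   : DecidableEquality V
    verts  : List V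
    edges  : List (List V)

open HGraph public

memᵇ : {A : Set} → DecidableEquality A → A → List A → Bool
memᵇ d x ys = any (λ y → does (d x y)) ys

deleteV : (G : HGraph) → V G → HGraph
deleteV G x = record
  { V     = V G
  ; decV  = decV G
  ; verts = filterᵇ (λ y → not (does (decV G x y))) (verts G)
  ; edges = filterᵇ (λ e → not (memᵇ (decV G) x e)) (edges G)
  }

sublists : {A : Set} → List A → List (List A)
sublists []       = [] ∷ []
sublists (x ∷ xs) = map (x ∷_) (sublists xs) ++ sublists xs

disjointᵇ : {A : Set} → DecidableEquality A → List A → List A → Bool
disjointᵇ d e f = all (λ x → not (memᵇ d x f)) e

pwDisjointᵇ : {A : Set} → DecidableEquality A → List (List A) → Bool
pwDisjointᵇ d []       = true
pwDisjointᵇ d (e ∷ es) = all (disjointᵇ d e) es ∧ pwDisjointᵇ d es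

numMatchings : HGraph → ℕ → ℕ
numMatchings G i =
  length (filterᵇ (λ M → (length M ≡ᵇ i) ∧ pwDisjointᵇ (decV G) M)
                  (sublists (edges G)))

-- Polynomials in x with integer coefficients, as coefficient functions
-- (value at j = coefficient of x^j).

Poly : Set
Poly = ℕ → ℤ

sumℤ : List ℤ → ℤ
sumℤ = foldr ℤ._+_ (+ 0)

_*ₚ_ : Poly → Poly → Poly
(f *ₚ g) j = sumℤ (map (λ a → f a ℤ.* g (j ∸ a)) (upTo (suc j)))

sign : ℕ → ℤ
sign zero    = + 1
sign (suc i) = ℤ.- sign i

-- m_k(G , x) = Σ_{i=0}^{⌊n/k⌋} (-1)^i p(G , i) x^{n - k i},  n = |V(G)|.
-- Coefficient of x^j: (-1)^i p(G,i) if k*i + j = n, and 0 otherwise.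
matchingPoly : ℕ → HGraph → Poly
matchingPoly k G j =
  sumℤ (map (λ i → if (k * i + j) ≡ᵇ n then sign i ℤ.* (+ numMatchings G i) else + 0)
            (upTo (suc n)))
  where n = length (verts G)

decFin : {n : ℕ} → DecidableEquality (Fin n)
decFin = Fin._≟_

decSubset : {n : ℕ} → DecidableEquality (Subset n)
decSubset = VP.≡-dec BP._≟_

subsetToList : {n : ℕ} → Subset n → List (Fin n)
subsetToList {n} e = filterᵇ (λ u → does (u ∈? e)) (allFin n)

toHGraph : (n : ℕ) → List (Subset n) → HGraph
toHGraph n E = record
  { V = Fin n ; decV = decFin ; verts = allFin n ; edges = map subsetToList E }

-- Conflict-free walks.  A walk (v₀ , e₁ , v₁ , … , e_ℓ , v_ℓ) starting at
-- the fixed vertex v₀ = v is represented by its list of steps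
-- ((e₁ , v₁) ∷ … ∷ (e_ℓ , v_ℓ) ∷ []); the one-vertex walk (v) is [].
-- The linear order ≺ on V(H) is given by an injective rank : Fin n → ℕ,
-- u ≺ w  iff  rank u < rank w.

Walk : ℕ → Set
Walk n = List (Subset n × Fin n)

decWalk : {n : ℕ} → DecidableEquality (Walk n)
decWalk = LP.≡-dec (PP.≡-dec decSubset (λ {_} → decFin))

endV : {n : ℕ} → Fin n → Walk n → Fin n
endV v []             = v
endV v ((e , u) ∷ ws) = endV u ws

Disjoint : {n : ℕ} → Subset n → Subset n → Set
Disjoint p q = ∀ w → w ∈ p → w ∈ q → Empty

Cset : {n : ℕ} → (Fin n → ℕ) → Fin n → Subset n → Fin n → Subset n
Cset rank prev e cur =
  Vec.tabulate (λ w → does (w ∈? e) ∧ ℕ._<ᵇ_ (rank w) (rank cur)) ∪ ⁅ prev ⁆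

-- Step conditions, with `prev` the current end vertex and `C` the union of
-- the C_j of the previous steps: e_i ∈ E, v_{i-1} , v_i ∈ e_i, and e_i is
-- disjoint from C_1 ∪ … ∪ C_{i-1} (vacuous for i = 1 since C = ∅).
Steps : {n : ℕ} → List (Subset n) → (Fin n → ℕ) → Fin n → Subset n → Walk n → Set
Steps E rank prev C []             = ⊤
Steps E rank prev C ((e , u) ∷ ws) =
  e LM.∈ E × prev ∈ e × u ∈ e × Disjoint e C
  × Steps E rank u (C ∪ Cset rank prev e u) ws

CFWalk : {n : ℕ} → List (Subset n) → (Fin n → ℕ) → Fin n → Walk n → Set
CFWalk E rank v W =
  Unique (v ∷ map proj₂ W) × Unique (map proj₁ W) × Steps E rank v ⊥ W

-- The k-walk-tree T(H , v), given the (duplicate-free) list TV of all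
-- conflict-free walks starting at v.  For every W₀ ∈ TV and edge e ∈ E
-- containing the end u₀ of W₀, the set {W₀} ∪ {W₀ e u : u ∈ e , u ≠ u₀}
-- is an edge, provided each W₀ e u is a conflict-free walk (∈ TV).

walkTree : {n : ℕ} → List (Subset n) → List (Walk n) → Fin n → HGraph
walkTree {n} E TV v = record
  { V = Walk n ; decV = decWalk ; verts = TV
  ; edges = concatMap (λ W₀ → concatMap (edgeAt W₀) E) TV }
  where
  ext : Walk n → Subset n → List (Walk n)
  ext W₀ e = map (λ u → W₀ ++ [ (e , u) ])
                 (filterᵇ (λ u → not (does (decFin (endV v W₀) u))) (subsetToList e))
  edgeAt : Walk n → Subset n → List (List (Walk n))
  edgeAt W₀ e =
    if does (endV v W₀ ∈? e) ∧ all (λ W → memᵇ decWalk W TV) (ext W₀ e)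
    then [ W₀ ∷ ext W₀ e ] else []

{-# OPTIONS --safe #-}

-- Replace m_k by the power series Σ_M (-Y)^|M| over matchings M, in which the
-- vertex count plays no role.  Let h(C) be this series for the edges of H that
-- avoid C, and t(v,C), t°(v,C) those of the walk tree of H - C rooted at v with and
-- without its root.  Expanding along the edges at v gives
--   h(C) = h(C∪v) - Y Σ_{e∋v} h(C∪e),
-- while the tree splits into branches (e , u) rooted at u, with forbidden set
-- C_{e,u} = C ∪ {v} ∪ {w ∈ e : w ≺ u}.  Taking the u ∈ e - v in increasing order,
-- the induction hypotheses t(u,C_{e,u}) h(C_{e,u}∪u) = t°(u,C_{e,u}) h(C_{e,u})
-- telescope to Π_u t°(u,C_{e,u}) · h(C∪v) = Π_u t(u,C_{e,u}) · h(C∪e), and these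
-- identities combine to t(v,C) h(C∪v) = t°(v,C) h(C) without any division.
module Submission where

open import Defs
open import Algebra.Bundles using (CommutativeSemiring)
open import Algebra.Properties.CommutativeSemigroup using (interchange)
open import Algebra.Structures.Biased using (isCommutativeSemiringˡ)
open import Data.Bool as Bool using (Bool; true; false; _∧_; if_then_else_; not)
open import Data.Bool.ListAction using (all)
import Data.Bool.Properties as BP
open import Data.Empty using (⊥; ⊥-elim)
open import Data.Fin as Fin using (Fin)
open import Data.Fin.Subset as Sub using (Subset; ∣_∣; ⁅_⁆; _∪_)
open import Data.Fin.Subset.Properties as SP using (_∈?_)
open import Data.Integer as ℤ using (ℤ; +_; 0ℤ; 1ℤ)
import Data.Integer.Properties as ℤP
open import Data.Integer.Tactic.RingSolver using (solve-∀)
open import Data.List using (List; []; _∷_; [_]; map; _++_; concat; concatMap; filterᵇ; foldr;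
  length; null; upTo; allFin; tabulate; cartesianProduct)
open import Data.List.Membership.Propositional using (_∈_; find; lose)
open import Data.List.Membership.Propositional.Properties
  using (∈-++⁻; ∈-map⁻; ∈-map⁺; ∈-allFin; ∈-concat⁻′; ∈-concatMap⁻; ∈-concatMap⁺;
         ∈-cartesianProduct⁺; ∈-cartesianProduct⁻)
open import Data.List.Membership.Propositional.Properties.WithK using (unique∧set⇒bag)
import Data.List.Properties as LP
open import Data.List.Relation.Binary.BagAndSetEquality using (∼bag⇒↭)
open import Data.List.Relation.Binary.Permutation.Propositional as Perm using (_↭_; ↭-sym; ↭⇒↭ₛ)
open import Data.List.Relation.Binary.Permutation.Propositional.Properties using (∈-resp-↭)
import Data.List.Relation.Binary.Permutation.Setoid.Properties as PermSetoid
open import Data.List.Relation.Unary.All as All using (All; []; _∷_)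
open import Data.List.Relation.Unary.AllPairs as AllPairs using (AllPairs; []; _∷_)
import Data.List.Relation.Unary.AllPairs.Properties as AP
open import Data.List.Relation.Unary.Any using (Any; here; there)
import Data.List.Relation.Unary.Sorted.TotalOrder.Properties as Sorted
open import Data.List.Relation.Unary.Unique.Propositional using (Unique)
import Data.List.Relation.Unary.Unique.Propositional.Properties as UP
import Data.List.Sort as Sort
open import Data.Nat as ℕ using (ℕ; zero; suc; _≤_; _<_; _∸_; _≡ᵇ_; z≤n; s≤s; NonZero)
import Data.Nat.Properties as ℕP
open import Data.Product using (_×_; _,_; proj₁; proj₂; ∃)
open import Data.Sum using (_⊎_; inj₁; inj₂)
open import Data.Unit using (⊤; tt)
open import Data.Vec as Vec using ()
import Data.Vec.Properties as VP
open import Function using (_∘_; id)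
open import Function.Bundles using (_⇔_; mk⇔; Equivalence)
open import Function.Definitions using (Injective)
open import Level using (0ℓ)
import Relation.Binary.Construct.On as On
open import Relation.Binary.Definitions using (DecidableEquality)
open import Relation.Binary.PropositionalEquality as ≡
  using (_≡_; _≢_; refl; sym; trans; cong; cong₂; subst; module ≡-Reasoning)
open import Relation.Binary.Structures using (IsEquivalence)
open import Relation.Nullary using (Dec; does; yes; no; ¬_)
open import Relation.Nullary.Decidable using (dec-true; dec-false)

-- Weighted sums over independent sets

-- The induction cannot stay among the trees T(H,v): what lies below a walk depends on its end and
-- on the union of its sets C_j. Every series therefore carries a forbidden set C, and the theorem
-- is the case of empty C. The linear order is there for the telescoping: C_{e,u} together with u is
-- exactly the forbidden set of the next larger child, so a right-hand factor h of one induction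
-- hypothesis is the left-hand factor of the next. Passing to series hides powers of x that differ
-- for the four hypergraphs. The way back is Y = x^(-k) followed by multiplication by x^n. It
-- respects products only when no negative exponent is cut off, which holds because a matching of
-- size i covers k i vertices; the walk tree must be shown uniform for this. The definition of the
-- walk tree tests extensions for being walks and never tests an edge against C directly. As k ≥ 2,
-- every candidate edge has at least one extension, and that extension reveals that the edge avoids
-- C.

module IndependenceSum (R : CommutativeSemiring 0ℓ 0ℓ)
                       (w : CommutativeSemiring.Carrier R) where
  open CommutativeSemiring R
    renaming (refl to ≈-refl; sym to ≈-sym; trans to ≈-trans; reflexive to ≈-reflexive)
  open import Algebra.Solver.Ring.NaturalCoefficients.Default R
  open import Relation.Binary.Reasoning.Setoid setoid

  -- Sum of w ^ length M over the sublists M of L whose entries satisfy p and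
  -- are pairwise compatible.
  J : {A : Set} → (A → A → Bool) → (A → Bool) → List A → Carrier
  J c p []      = 1#
  J c p (x ∷ L) = J c p L + (if p x then w * J c (λ y → p y ∧ c x y) L else 0#)

  if-cong : ∀ {b b′ x x′} → b ≡ b′ → x ≈ x′ → (if b then x else 0#) ≈ (if b′ then x′ else 0#)
  if-cong {true}  refl q = q
  if-cong {false} refl q = ≈-refl

  if-false : ∀ {b x} → b ≡ false → (if b then x else 0#) ≈ 0#
  if-false refl = ≈-refl

  if-true : ∀ {b x} → b ≡ true → (if b then x else 0#) ≈ x
  if-true refl = ≈-refl

  J-cong : ∀ {A c} {p q : A → Bool} L → (∀ x → x ∈ L → p x ≡ q x) → J c p L ≈ J c q L
  J-cong []      h = ≈-refl
  J-cong {c = c} (x ∷ L) h = +-cong (J-cong L λ y y∈ → h y (there y∈))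
    (if-cong (h x (here refl))
      (*-congˡ (J-cong L λ y y∈ → cong (_∧ c x y) (h y (there y∈)))))

  J-map : ∀ {A B c d} {p : B → Bool} (f : A → B) L →
    (∀ x y → x ∈ L → y ∈ L → c (f x) (f y) ≡ d x y) → J c p (map f L) ≈ J d (p ∘ f) L
  J-map f []      h = ≈-refl
  J-map {p = p} f (x ∷ L) h = +-cong
    (J-map f L (λ y z y∈ z∈ → h y z (there y∈) (there z∈)))
    (if-cong refl (*-congˡ (≈-trans
      (J-map f L (λ y z y∈ z∈ → h y z (there y∈) (there z∈)))
      (J-cong L λ y y∈ → cong (p (f y) ∧_) (h x y (here refl) (there y∈))))))

  J-filter : ∀ {A c} {p : A → Bool} (q : A → Bool) L →
    J c p (filterᵇ q L) ≈ J c (λ x → q x ∧ p x) L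
  J-filter q [] = ≈-refl
  J-filter {c = c} {p = p} q (x ∷ L) with q x
  ... | false = ≈-trans (J-filter q L) (≈-sym (+-identityʳ _))
  ... | true  = +-cong (J-filter q L) (if-cong {p x} refl (*-congˡ (≈-trans (J-filter q L)
    (J-cong L λ y _ → sym (BP.∧-assoc (q y) (p y) (c x y))))))

  J-++ : ∀ {A c} {p : A → Bool} L L′ → (∀ x y → x ∈ L → y ∈ L′ → c x y ≡ true) →
    J c p (L ++ L′) ≈ J c p L * J c p L′
  J-++ [] L′ h = ≈-sym (*-identityˡ _)
  J-++ {c = c} {p} (x ∷ L) L′ h with p x
  ... | false = ≈-trans (+-identityʳ _) (≈-trans (J-++ L L′ (λ y z y∈ → h y z (there y∈)))
                  (*-congʳ (≈-sym (+-identityʳ _))))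
  ... | true  = ≈-trans (+-cong (J-++ L L′ h′) (*-congˡ (≈-trans (J-++ L L′ h′)
      (*-congˡ (J-cong L′ λ y y∈ → trans
        (cong (p y ∧_) (h x y (here refl) y∈)) (BP.∧-identityʳ (p y)))))))
      (solve 4 (λ a b w d → (a :* b) :+ (w :* (d :* b)) := (a :+ w :* d) :* b) ≈-refl _ _ _ _)
    where
    h′ : ∀ y z → y ∈ L → z ∈ L′ → c y z ≡ true
    h′ y z y∈ = h y z (there y∈)

  ∧-swapʳ : ∀ a b c → (a ∧ b) ∧ c ≡ (a ∧ c) ∧ b
  ∧-swapʳ a b c = trans (BP.∧-assoc a b c)
    (trans (cong (a ∧_) (BP.∧-comm b c)) (sym (BP.∧-assoc a c b)))

  -- Only the swap of neighbours x and y has content: choosing just x and choosing just y trade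
  -- places, and the term with both is governed by `c x y`, which symmetry makes independent of the
  -- order.
  J-↭ : ∀ {A c} {p : A → Bool} → (∀ x y → c x y ≡ c y x) → ∀ {L L′} → L ↭ L′ →
    J c p L ≈ J c p L′
  J-↭ s Perm.refl = ≈-refl
  J-↭ s (Perm.prep x r) = +-cong (J-↭ s r) (if-cong refl (*-congˡ (J-↭ s r)))
  J-↭ s (Perm.trans r r′) = ≈-trans (J-↭ s r) (J-↭ s r′)
  J-↭ {c = c} {p} s (Perm.swap {xs} {ys} x y r) rewrite s y x with p x | p y | c x y
  ... | false | false | _ = +-cong (+-cong (J-↭ s r) ≈-refl) ≈-refl
  ... | false | true  | _ = ≈-trans (+-identityʳ _)
      (+-cong (≈-trans (J-↭ s r) (≈-sym (+-identityʳ _))) (*-congˡ (≈-trans (J-↭ s r) (≈-sym (+-identityʳ _)))))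
  ... | true  | false | _ = ≈-trans (+-cong (≈-trans (+-identityʳ _) (J-↭ s r))
      (*-congˡ (≈-trans (+-identityʳ _) (J-↭ s r)))) (≈-sym (+-identityʳ _))
  ... | true  | true  | false = ≈-trans
      (+-cong (+-cong (J-↭ s r) (*-congˡ (J-↭ s r))) (*-congˡ (+-congʳ (J-↭ s r))))
      (solve 4 (λ a b c w → (a :+ w :* b) :+ w :* (c :+ con 0)
                         := (a :+ w :* c) :+ w :* (b :+ con 0)) ≈-refl _ _ _ _)
  ... | true  | true  | true  = ≈-trans
      (+-cong (+-cong (J-↭ s r) (*-congˡ (J-↭ s r)))
        (*-congˡ (+-cong (J-↭ s r) (*-congˡ (≈-trans (J-↭ s r)
          (J-cong ys λ z _ → ∧-swapʳ (p z) (c x z) (c y z)))))))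
      (solve 5 (λ a b c d w → (a :+ w :* b) :+ w :* (c :+ w :* d)
                         := (a :+ w :* c) :+ w :* (b :+ w :* d)) ≈-refl _ _ _ _ _)

  ∑ : {A : Set} → (A → Carrier) → List A → Carrier
  ∑ f = foldr (λ x s → f x + s) 0#

  ∏ : {A : Set} → (A → Carrier) → List A → Carrier
  ∏ f = foldr (λ x s → f x * s) 1#

  ∑-cong : ∀ {A : Set} {f g : A → Carrier} L → (∀ x → x ∈ L → f x ≈ g x) → ∑ f L ≈ ∑ g L
  ∑-cong []      h = ≈-refl
  ∑-cong (x ∷ L) h = +-cong (h x (here refl)) (∑-cong L λ y y∈ → h y (there y∈))

  ∏-cong : ∀ {A : Set} {f g : A → Carrier} L → (∀ x → x ∈ L → f x ≈ g x) → ∏ f L ≈ ∏ g L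
  ∏-cong []      h = ≈-refl
  ∏-cong (x ∷ L) h = *-cong (h x (here refl)) (∏-cong L λ y y∈ → h y (there y∈))

  J-concatMap : ∀ {A B c} {p : B → Bool} (f : A → List B) xs → Unique xs →
    (∀ x y → x ≢ y → ∀ a b → a ∈ f x → b ∈ f y → c a b ≡ true) →
    J c p (concatMap f xs) ≈ ∏ (λ x → J c p (f x)) xs
  J-concatMap f [] u h = ≈-refl
  J-concatMap {c = c} f (x ∷ xs) (x∉ ∷ u) h =
    ≈-trans (J-++ (f x) (concatMap f xs) λ a b a∈ b∈ → cross a b xs x∉ a∈ (∈-concatMap⁻ f b∈))
          (*-congˡ (J-concatMap f xs u h))
    where
    cross : ∀ a b ys → All (x ≢_) ys → a ∈ f x → Any ((b ∈_) ∘ f) ys → c a b ≡ true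
    cross a b (y ∷ ys) (n ∷ _) a∈ (here b∈)  = h x y n a b a∈ b∈
    cross a b (y ∷ ys) (_ ∷ n) a∈ (there b∈) = cross a b ys n a∈ b∈

  J-skip : ∀ {A c} {p : A → Bool} {x} L → p x ≡ false → J c p (x ∷ L) ≈ J c p L
  J-skip L px rewrite px = +-identityʳ _

  J-take : ∀ {A c} {p : A → Bool} {x} L → p x ≡ true →
    J c p (x ∷ L) ≈ J c p L + w * J c (λ y → p y ∧ c x y) L
  J-take L px rewrite px = ≈-refl

  ∑-+ : ∀ {A : Set} (f g : A → Carrier) L → ∑ (λ x → f x + g x) L ≈ ∑ f L + ∑ g L
  ∑-+ f g []      = ≈-sym (+-identityʳ _)
  ∑-+ f g (x ∷ L) = ≈-trans (+-congˡ (∑-+ f g L))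
    (solve 4 (λ a b c d → (a :+ b) :+ (c :+ d) := (a :+ c) :+ (b :+ d)) ≈-refl _ _ _ _)

  ∑-* : ∀ {A : Set} a (f : A → Carrier) L → ∑ (λ x → a * f x) L ≈ a * ∑ f L
  ∑-* a f []      = ≈-sym (zeroʳ a)
  ∑-* a f (x ∷ L) = ≈-trans (+-congˡ (∑-* a f L)) (≈-sym (distribˡ a _ _))

  ∑-filter : ∀ {A : Set} (q : A → Bool) (f : A → Carrier) L →
    ∑ f (filterᵇ q L) ≈ ∑ (λ x → if q x then f x else 0#) L
  ∑-filter q f [] = ≈-refl
  ∑-filter q f (x ∷ L) with q x
  ... | false = ≈-trans (∑-filter q f L) (≈-sym (+-identityˡ _))
  ... | true  = +-congˡ (∑-filter q f L)

  -- At most one entry of a clique q occurs in a compatible sublist.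
  J-clique : ∀ {A c} (p q : A → Bool) → (∀ x y → c x y ≡ c y x) → ∀ L →
    (∀ x y → x ∈ L → y ∈ L → q x ≡ true → q y ≡ true → c x y ≡ false) →
    J c p L ≈ J c (λ x → p x ∧ not (q x)) L
            + w * ∑ (λ x → if q x ∧ p x then J c (λ y → p y ∧ c x y) L else 0#) L
  J-clique p q s [] h = solve 1 (λ w → con 1 := con 1 :+ w :* con 0) ≈-refl w
  J-clique {A} {c} p q s (x ∷ L) h = go (q x) (p x) refl refl
    where
    h′ : ∀ y z → y ∈ L → z ∈ L → q y ≡ true → q z ≡ true → c y z ≡ false
    h′ y z y∈ z∈ = h y z (there y∈) (there z∈)
    term : List A → A → Carrier
    term L′ y = if q y ∧ p y then J c (λ z → p z ∧ c y z) L′ else 0#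
    p¬q : A → Bool
    p¬q y = p y ∧ not (q y)
    skip-term : ∀ y → (q y ≡ true → p x ∧ c y x ≡ false) → term (x ∷ L) y ≈ term L y
    skip-term y e with q y | p y
    ... | false | _     = ≈-refl
    ... | true  | false = ≈-refl
    ... | true  | true  = J-skip L (e refl)
    extra : A → Carrier
    extra y = if q y ∧ (p y ∧ c x y) then J c (λ z → (p z ∧ c x z) ∧ c y z) L else 0#
    take-term : p x ≡ true → ∀ y → term (x ∷ L) y ≈ term L y + w * extra y
    take-term px y with q y | p y
    ... | false | _     = solve 1 (λ w → con 0 := con 0 :+ w :* con 0) ≈-refl w
    ... | true  | false = solve 1 (λ w → con 0 := con 0 :+ w :* con 0) ≈-refl w
    ... | true  | true  rewrite px | s y x with c x y
    ...   | false = +-congˡ (≈-sym (zeroʳ w))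
    ...   | true  = +-congˡ (*-congˡ (J-cong L λ z _ → ∧-swapʳ (p z) (c y z) (c x z)))
    go : ∀ a b → q x ≡ a → p x ≡ b →
      J c p (x ∷ L) ≈ J c p¬q (x ∷ L) + w * ∑ (term (x ∷ L)) (x ∷ L)
    go a false qx px = begin
      J c p (x ∷ L)                           ≈⟨ J-skip L px ⟩
      J c p L                                 ≈⟨ J-clique p q s L h′ ⟩
      J c p¬q L + w * ∑ (term L) L            ≈⟨ +-cong (≈-sym (J-skip L (cong (_∧ not (q x)) px)))
                                                 (*-congˡ (≈-sym (≈-trans (+-cong head tail) (+-identityˡ _)))) ⟩
      J c p¬q (x ∷ L) + w * ∑ (term (x ∷ L)) (x ∷ L) ∎
      where
      head : term (x ∷ L) x ≈ 0#
      head = if-false (trans (cong (q x ∧_) px) (BP.∧-zeroʳ (q x)))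
      tail : ∑ (term (x ∷ L)) L ≈ ∑ (term L) L
      tail = ∑-cong L λ y _ → skip-term y λ _ → cong (_∧ c y x) px
    go true true qx px = begin
      J c p (x ∷ L)                             ≈⟨ J-take L px ⟩
      J c p L + w * K                           ≈⟨ +-congʳ (J-clique p q s L h′) ⟩
      (J c p¬q L + w * ∑ (term L) L) + w * K    ≈⟨ solve 4 (λ a b d w → (a :+ w :* b) :+ w :* d
                                                     := a :+ w :* (d :+ b)) ≈-refl _ _ _ _ ⟩
      J c p¬q L + w * (K + ∑ (term L) L)        ≈⟨ +-cong (≈-sym (J-skip L (cong₂ _∧_ px (cong not qx))))
                                                     (*-congˡ (≈-sym (+-cong head tail))) ⟩
      J c p¬q (x ∷ L) + w * ∑ (term (x ∷ L)) (x ∷ L) ∎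
      where
      K : Carrier
      K = J c (λ y → p y ∧ c x y) L
      -- The clique hypothesis includes the pair (x , x), so `c x x` is false and x is not chosen a
      -- second time.
      head : term (x ∷ L) x ≈ K
      head = ≈-trans (if-true (cong₂ _∧_ qx px))
        (J-skip L (trans (cong (p x ∧_) (h x x (here refl) (here refl) qx qx)) (BP.∧-zeroʳ (p x))))
      tail : ∑ (term (x ∷ L)) L ≈ ∑ (term L) L
      tail = ∑-cong L λ y y∈ → skip-term y λ qy →
        trans (cong (p x ∧_) (h y x (there y∈) (here refl) qy qx)) (BP.∧-zeroʳ (p x))
    -- Here x lies outside the clique, so the expansion is applied twice, to the selections without
    -- x and to those with x. `take-term` recombines the two sums entry by entry.
    go false true qx px = begin
      J c p (x ∷ L)                             ≈⟨ J-take L px ⟩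
      J c p L + w * K                           ≈⟨ +-cong (J-clique p q s L h′)
                                                     (*-congˡ (J-clique _ q s L h′)) ⟩
      (J c p¬q L + w * ∑ (term L) L) + w * (K¬q + w * ∑ extra L)
                                                ≈⟨ solve 5 (λ a b d e w → (a :+ w :* b) :+ w :* (d :+ w :* e)
                                                     := (a :+ w :* d) :+ w :* (b :+ w :* e)) ≈-refl _ _ _ _ _ ⟩
      (J c p¬q L + w * K¬q) + w * (∑ (term L) L + w * ∑ extra L)
                                                ≈⟨ +-cong (≈-sym first) (*-congˡ (≈-sym rest)) ⟩
      J c p¬q (x ∷ L) + w * ∑ (term (x ∷ L)) (x ∷ L) ∎
      where
      K K¬q : Carrier
      K = J c (λ y → p y ∧ c x y) L
      K¬q = J c (λ y → (p y ∧ c x y) ∧ not (q y)) L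
      first : J c p¬q (x ∷ L) ≈ J c p¬q L + w * K¬q
      first = ≈-trans (J-take L (cong₂ _∧_ px (cong not qx)))
        (+-congˡ (*-congˡ (J-cong L λ y _ → ∧-swapʳ (p y) (not (q y)) (c x y))))
      rest : ∑ (term (x ∷ L)) (x ∷ L) ≈ ∑ (term L) L + w * ∑ extra L
      rest = begin
        term (x ∷ L) x + ∑ (term (x ∷ L)) L
          ≈⟨ +-cong (if-false (cong (_∧ p x) qx))
                    (∑-cong L λ y _ → take-term px y) ⟩
        0# + ∑ (λ y → term L y + w * extra y) L ≈⟨ +-identityˡ _ ⟩
        ∑ (λ y → term L y + w * extra y) L      ≈⟨ ∑-+ (term L) (λ y → w * extra y) L ⟩
        ∑ (term L) L + ∑ (λ y → w * extra y) L  ≈⟨ +-congˡ (∑-* w extra L) ⟩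
        ∑ (term L) L + w * ∑ extra L ∎

-- Boolean tests and duplicate-free lists

⇔⇒≡ : ∀ {a b} → (a ≡ true → b ≡ true) → (b ≡ true → a ≡ true) → a ≡ b
⇔⇒≡ {true}  {b}     f g = sym (f refl)
⇔⇒≡ {false} {true}  f g = g refl
⇔⇒≡ {false} {false} f g = refl

∧-true : ∀ {a b} → a ∧ b ≡ true → a ≡ true × b ≡ true
∧-true {true} {true} _ = refl , refl

does⁻ : {P : Set} (p? : Dec P) → does p? ≡ true → P
does⁻ (yes p) _ = p

does⁺ : {P : Set} (p? : Dec P) → P → does p? ≡ true
does⁺ = dec-true

not-does⁺ : {P : Set} (p? : Dec P) → ¬ P → not (does p?) ≡ true
not-does⁺ p? ¬p = cong not (dec-false p? ¬p)

not-does⁻ : {P : Set} (p? : Dec P) → not (does p?) ≡ true → ¬ P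
not-does⁻ (no ¬p) _ = ¬p

module _ {A : Set} where

  ∈-filterᵇ⁺ : ∀ (q : A → Bool) {x L} → x ∈ L → q x ≡ true → x ∈ filterᵇ q L
  ∈-filterᵇ⁺ q {x} (here {xs = L} refl) e rewrite e = here refl
  ∈-filterᵇ⁺ q {x} (there {x = y} x∈) e with q y
  ... | true  = there (∈-filterᵇ⁺ q x∈ e)
  ... | false = ∈-filterᵇ⁺ q x∈ e

  ∈-filterᵇ⁻ : ∀ (q : A → Bool) {x} L → x ∈ filterᵇ q L → x ∈ L × q x ≡ true
  ∈-filterᵇ⁻ q (y ∷ L) x∈ with q y in qy
  ∈-filterᵇ⁻ q (y ∷ L) (here refl) | true = here refl , qy
  ∈-filterᵇ⁻ q (y ∷ L) (there x∈)  | true =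
    let x∈L , qx = ∈-filterᵇ⁻ q L x∈ in there x∈L , qx
  ∈-filterᵇ⁻ q (y ∷ L) x∈ | false = let x∈L , qx = ∈-filterᵇ⁻ q L x∈ in there x∈L , qx

  all⁻ : ∀ (q : A → Bool) L → all q L ≡ true → ∀ x → x ∈ L → q x ≡ true
  all⁻ q (y ∷ L) e x (here refl) = proj₁ (∧-true e)
  all⁻ q (y ∷ L) e x (there x∈)  = all⁻ q L (proj₂ (∧-true {q y} e)) x x∈

  all⁺ : ∀ (q : A → Bool) L → (∀ x → x ∈ L → q x ≡ true) → all q L ≡ true
  all⁺ q []      h = refl
  all⁺ q (y ∷ L) h = cong₂ _∧_ (h y (here refl)) (all⁺ q L λ x x∈ → h x (there x∈))

module _ {A : Set} (d : DecidableEquality A) where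

  memᵇ⁻ : ∀ x ys → memᵇ d x ys ≡ true → x ∈ ys
  memᵇ⁻ x (y ∷ ys) e with d x y
  ... | yes x≡y = here x≡y
  ... | no  _   = there (memᵇ⁻ x ys e)

  memᵇ⁺ : ∀ x ys → x ∈ ys → memᵇ d x ys ≡ true
  memᵇ⁺ x (y ∷ ys) x∈ with d x y | x∈
  ... | yes _  | _         = refl
  ... | no x≢y | here x≡y  = ⊥-elim (x≢y x≡y)
  ... | no _   | there x∈′ = memᵇ⁺ x ys x∈′

  ¬memᵇ⁺ : ∀ x ys → ¬ (x ∈ ys) → not (memᵇ d x ys) ≡ true
  ¬memᵇ⁺ x ys x∉ with memᵇ d x ys in e
  ... | true  = ⊥-elim (x∉ (memᵇ⁻ x ys e))
  ... | false = refl

  ¬memᵇ⁻ : ∀ x ys → not (memᵇ d x ys) ≡ true → ¬ (x ∈ ys)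
  ¬memᵇ⁻ x ys e x∈ with trans (sym (cong not (memᵇ⁺ x ys x∈))) e
  ... | ()

  disjointᵇ⁻ : ∀ xs ys → disjointᵇ d xs ys ≡ true → ∀ {x} → x ∈ xs → x ∈ ys → ⊥
  disjointᵇ⁻ xs ys e {x} x∈xs = ¬memᵇ⁻ x ys (all⁻ (λ x → not (memᵇ d x ys)) xs e x x∈xs)

  disjointᵇ⁺ : ∀ xs ys → (∀ {x} → x ∈ xs → x ∈ ys → ⊥) → disjointᵇ d xs ys ≡ true
  disjointᵇ⁺ xs ys h = all⁺ _ xs λ x x∈ → ¬memᵇ⁺ x ys (h x∈)

  disjointᵇ-false : ∀ xs ys {x} → x ∈ xs → x ∈ ys → disjointᵇ d xs ys ≡ false
  disjointᵇ-false xs ys x∈ x∈′ with disjointᵇ d xs ys in e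
  ... | true  = ⊥-elim (disjointᵇ⁻ xs ys e x∈ x∈′)
  ... | false = refl

  disjointᵇ-sym : ∀ xs ys → disjointᵇ d xs ys ≡ disjointᵇ d ys xs
  disjointᵇ-sym xs ys = ⇔⇒≡ (flip xs ys) (flip ys xs)
    where
    flip : ∀ xs ys → disjointᵇ d xs ys ≡ true → disjointᵇ d ys xs ≡ true
    flip xs ys e = disjointᵇ⁺ ys xs λ x∈ x∈′ → disjointᵇ⁻ xs ys e x∈′ x∈

  remove : A → List A → List A
  remove x = filterᵇ (λ y → not (does (d x y)))

  ∈-remove⁺ : ∀ {x y ys} → x ≢ y → y ∈ ys → y ∈ remove x ys
  ∈-remove⁺ {x} {y} x≢y y∈ = ∈-filterᵇ⁺ _ y∈ (not-does⁺ (d x y) x≢y)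

  ∈-remove⁻ : ∀ {x y} ys → y ∈ remove x ys → y ∈ ys × x ≢ y
  ∈-remove⁻ {x} {y} ys y∈ =
    let y∈ys , e = ∈-filterᵇ⁻ _ ys y∈ in y∈ys , not-does⁻ (d x y) e

  remove-absent : ∀ {x} ys → All (x ≢_) ys → remove x ys ≡ ys
  remove-absent []       []       = refl
  remove-absent {x} (y ∷ ys) (n ∷ ns) with d x y
  ... | yes e = ⊥-elim (n e)
  ... | no _  = cong (y ∷_) (remove-absent ys ns)

  length-remove : ∀ {x} ys → Unique ys → x ∈ ys → suc (length (remove x ys)) ≡ length ys
  length-remove {x} (y ∷ ys) (n ∷ u) x∈ with d x y | x∈
  ... | yes refl | _         = cong (suc ∘ length) (remove-absent ys n)
  ... | no x≢y   | here x≡y  = ⊥-elim (x≢y x≡y)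
  ... | no _     | there x∈′ = cong suc (length-remove ys u x∈′)

  length-remove-≤ : ∀ {x} ys → length (remove x ys) ≤ length ys
  length-remove-≤ ys = LP.length-filter _ ys

  length-remove-< : ∀ {x} ys → x ∈ ys → length (remove x ys) < length ys
  length-remove-< {x} (y ∷ ys) x∈ with d x y | x∈
  ... | yes _  | _         = s≤s (length-remove-≤ ys)
  ... | no x≢y | here x≡y  = ⊥-elim (x≢y x≡y)
  ... | no _   | there x∈′ = s≤s (length-remove-< ys x∈′)

  unique⊆⇒length≤ : ∀ {xs} ys → Unique xs → (∀ {x} → x ∈ xs → x ∈ ys) → length xs ≤ length ys
  unique⊆⇒length≤ {[]}     ys u       h = z≤n
  unique⊆⇒length≤ {x ∷ xs} ys (n ∷ u) h = ℕP.<-≤-trans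
    (s≤s (unique⊆⇒length≤ (remove x ys) u λ y∈ →
      ∈-remove⁺ (All.lookup n y∈) (h (there y∈))))
    (length-remove-< ys (h (here refl)))

-- Subsets as lists, and their disjointness

∈-subsetToList⁺ : ∀ {n} {e : Subset n} {u} → u Sub.∈ e → u ∈ subsetToList e
∈-subsetToList⁺ {e = e} {u} u∈ = ∈-filterᵇ⁺ _ (∈-allFin u) (does⁺ (u ∈? e) u∈)

∈-subsetToList⁻ : ∀ {n} {e : Subset n} {u} → u ∈ subsetToList e → u Sub.∈ e
∈-subsetToList⁻ {n} {e} {u} u∈ = does⁻ (u ∈? e) (proj₂ (∈-filterᵇ⁻ _ (allFin n) u∈))

filterᵇ-unique : ∀ {A : Set} (q : A → Bool) {L} → Unique L → Unique (filterᵇ q L)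
filterᵇ-unique q = UP.filter⁺ (λ x → BP.T? (q x))

subsetToList-unique : ∀ {n} (e : Subset n) → Unique (subsetToList e)
subsetToList-unique {n} e = filterᵇ-unique _ (UP.allFin⁺ n)

module _ {n : ℕ} (rank : Fin n → ℕ) {v : Fin n} {e : Subset n} {u : Fin n} where

  lower? : Fin n → Bool
  lower? w = does (w ∈? e) ∧ (rank w ℕ.<ᵇ rank u)

  ∈-Cset⁺ˡ : ∀ {w} → w Sub.∈ e → rank w < rank u → w Sub.∈ Cset rank v e u
  ∈-Cset⁺ˡ {w} w∈ lt = SP.p⊆p∪q ⁅ v ⁆ (VP.lookup⇒[]= w _ (trans (VP.lookup∘tabulate lower? w)
    (cong₂ _∧_ (does⁺ (w ∈? e) w∈) (does⁺ (rank w ℕP.<? rank u) lt))))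

  ∈-Cset⁺ʳ : v Sub.∈ Cset rank v e u
  ∈-Cset⁺ʳ = SP.q⊆p∪q (Vec.tabulate lower?) ⁅ v ⁆ (SP.x∈⁅x⁆ v)

  ∈-Cset⁻ : ∀ {w} → w Sub.∈ Cset rank v e u → (w Sub.∈ e × rank w < rank u) ⊎ w ≡ v
  ∈-Cset⁻ {w} w∈ with SP.x∈p∪q⁻ (Vec.tabulate lower?) ⁅ v ⁆ w∈
  ... | inj₂ w∈v = inj₂ (SP.x∈⁅y⁆⇒x≡y v w∈v)
  ... | inj₁ w∈t = inj₁ (does⁻ (w ∈? e) (proj₁ b) ,
    does⁻ (rank w ℕP.<? rank u) (proj₂ (∧-true {does (w ∈? e)} e′)))
    where
    e′ : lower? w ≡ true
    e′ = trans (sym (VP.lookup∘tabulate lower? w)) (VP.[]=⇒lookup w∈t)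
    b = ∧-true e′

disjointᵇ-map : ∀ {A B : Set} (d : DecidableEquality A) (d′ : DecidableEquality B) (f : A → B) →
  (∀ {x y} → f x ≡ f y → x ≡ y) → ∀ xs ys →
  disjointᵇ d′ (map f xs) (map f ys) ≡ disjointᵇ d xs ys
disjointᵇ-map d d′ f inj xs ys = ⇔⇒≡
  (λ e → disjointᵇ⁺ d xs ys λ x∈ x∈′ →
    disjointᵇ⁻ d′ (map f xs) (map f ys) e (∈-map⁺ f x∈) (∈-map⁺ f x∈′))
  (λ e → disjointᵇ⁺ d′ (map f xs) (map f ys) λ y∈ y∈′ → shared e (∈-map⁻ f y∈) (∈-map⁻ f y∈′))
  where
  shared : disjointᵇ d xs ys ≡ true → ∀ {y} →
    ∃ (λ x → x ∈ xs × y ≡ f x) → ∃ (λ x → x ∈ ys × y ≡ f x) → ⊥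
  shared e (x , x∈ , p) (x′ , x′∈ , q) =
    disjointᵇ⁻ d xs ys e x∈ (subst (_∈ ys) (inj (trans (sym q) p)) x′∈)

∈-concatMap⁻′ : ∀ {A B : Set} (f : A → List B) xs {y} → y ∈ concatMap f xs →
  ∃ λ x → x ∈ xs × y ∈ f x
∈-concatMap⁻′ f xs y∈ = find (∈-concatMap⁻ f y∈)

∈-concatMap⁺′ : ∀ {A B : Set} (f : A → List B) {xs x y} → x ∈ xs → y ∈ f x → y ∈ concatMap f xs
∈-concatMap⁺′ f x∈ y∈ = ∈-concatMap⁺ f (lose x∈ y∈)

concatMap-unique : ∀ {A B : Set} (f : A → List B) xs → Unique xs →
  (∀ x → x ∈ xs → Unique (f x)) → (∀ x y → x ≢ y → ∀ {b} → b ∈ f x → b ∈ f y → ⊥) →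
  Unique (concatMap f xs)
concatMap-unique f []       u       h k = []
concatMap-unique f (x ∷ xs) (n ∷ u) h k = UP.++⁺ (h x (here refl))
  (concatMap-unique f xs u (λ y y∈ → h y (there y∈)) k)
  λ (b∈ , b∈′) → let y , y∈ , b∈y = ∈-concatMap⁻′ f xs b∈′ in
    k x y (All.lookup n y∈) b∈ b∈y

dis : ∀ {n} → Subset n → Subset n → Bool
dis C e = disjointᵇ decFin (subsetToList C) (subsetToList e)

dis⁻ : ∀ {n} (C e : Subset n) → dis C e ≡ true → ∀ {x} → x Sub.∈ C → x Sub.∈ e → ⊥
dis⁻ C e d x∈C x∈e = disjointᵇ⁻ decFin _ _ d (∈-subsetToList⁺ {e = C} x∈C) (∈-subsetToList⁺ x∈e)

dis⁺ : ∀ {n} (C e : Subset n) → (∀ {x} → x Sub.∈ C → x Sub.∈ e → ⊥) → dis C e ≡ true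
dis⁺ C e h = disjointᵇ⁺ decFin _ _ λ x∈C x∈e →
  h (∈-subsetToList⁻ {e = C} x∈C) (∈-subsetToList⁻ {e = e} x∈e)

dis-sym : ∀ {n} (C e : Subset n) → dis C e ≡ dis e C
dis-sym C e = disjointᵇ-sym decFin (subsetToList C) (subsetToList e)

dis-false : ∀ {n} (C e : Subset n) {x} → x Sub.∈ C → x Sub.∈ e → dis C e ≡ false
dis-false C e x∈C x∈e =
  disjointᵇ-false decFin _ _ (∈-subsetToList⁺ {e = C} x∈C) (∈-subsetToList⁺ x∈e)

dis-∪ : ∀ {n} (C D e : Subset n) → dis (C ∪ D) e ≡ dis C e ∧ dis D e
dis-∪ C D e = ⇔⇒≡
  (λ d → cong₂ _∧_ (dis⁺ C e λ x∈ → dis⁻ (C ∪ D) e d (SP.p⊆p∪q D x∈))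
                     (dis⁺ D e λ x∈ → dis⁻ (C ∪ D) e d (SP.q⊆p∪q C D x∈)))
  (λ d → dis⁺ (C ∪ D) e λ x∈ x∈e → case (∧-true {dis C e} d) (SP.x∈p∪q⁻ C D x∈) x∈e)
  where
  case : dis C e ≡ true × dis D e ≡ true → ∀ {x} → x Sub.∈ C ⊎ x Sub.∈ D → x Sub.∈ e → ⊥
  case (c , _) (inj₁ x∈) x∈e = dis⁻ C e c x∈ x∈e
  case (_ , d) (inj₂ x∈) x∈e = dis⁻ D e d x∈ x∈e

dis-⁅⁆ : ∀ {n} (v : Fin n) (e : Subset n) → dis ⁅ v ⁆ e ≡ not (does (v ∈? e))
dis-⁅⁆ v e with v ∈? e
... | yes v∈ = dis-false ⁅ v ⁆ e (SP.x∈⁅x⁆ v) v∈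
... | no  v∉ = dis⁺ ⁅ v ⁆ e λ x∈v x∈e → v∉ (subst (Sub._∈ e) (SP.x∈⁅y⁆⇒x≡y v x∈v) x∈e)

-- Walk trees

-- A hyperedge of the walk tree is encoded by its walk closest to the root
-- together with the edge appended to that walk.
Item : ℕ → Set
Item n = Walk n × Subset n

module _ {n : ℕ} where

  push : Subset n × Fin n → Item n → Item n
  push s (W , e) = s ∷ W , e

  push-injective : ∀ {s i j} → push s i ≡ push s j → i ≡ j
  push-injective refl = refl

  deep : Item n → Bool
  deep (W , e) = not (null W)

  hyperedge : Fin n → Item n → List (Walk n)
  hyperedge v (W , e) = W ∷ map (λ u → W ++ [ (e , u) ]) (remove decFin (endV v W) (subsetToList e))

  tc : Fin n → Item n → Item n → Bool
  tc v i j = disjointᵇ decWalk (hyperedge v i) (hyperedge v j)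

  hyperedge-push : ∀ v f u i → hyperedge v (push (f , u) i) ≡ map ((f , u) ∷_) (hyperedge u i)
  hyperedge-push v f u (W , e) = cong (((f , u) ∷ W) ∷_)
    (LP.map-∘ (remove decFin (endV u W) (subsetToList e)))

  -- Prefixing a step is injective on walks, so the part of the tree below a one-step walk is a
  -- faithful copy of a tree rooted at the end of that step.
  tc-push : ∀ v f u i j → tc v (push (f , u) i) (push (f , u) j) ≡ tc u i j
  tc-push v f u i j = trans
    (cong₂ (disjointᵇ decWalk) (hyperedge-push v f u i) (hyperedge-push v f u j))
    (disjointᵇ-map decWalk decWalk ((f , u) ∷_) (λ { refl → refl }) (hyperedge u i) (hyperedge u j))

  ∈-hyperedge-push : ∀ v f u i {W} → W ∈ hyperedge v (push (f , u) i) →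
    ∃ λ W′ → W′ ∈ hyperedge u i × W ≡ (f , u) ∷ W′
  ∈-hyperedge-push v f u i {W} W∈ =
    ∈-map⁻ ((f , u) ∷_) (subst (W ∈_) (hyperedge-push v f u i) W∈)

  ∈-hyperedge-[] : ∀ v e {W} → W ∈ hyperedge v ([] , e) → W ≡ [] ⊎ ∃ λ u → W ≡ [ (e , u) ]
  ∈-hyperedge-[] v e (here p)   = inj₁ p
  ∈-hyperedge-[] v e (there W∈) = let u , _ , p = ∈-map⁻ (λ u → [ (e , u) ]) W∈ in inj₂ (u , p)

  tc-push-≢ : ∀ v {s s′} i j → s ≢ s′ → tc v (push s i) (push s′ j) ≡ true
  tc-push-≢ v {f , u} {f′ , u′} i j s≢ =
    disjointᵇ⁺ decWalk (hyperedge v (push (f , u) i)) (hyperedge v (push (f′ , u′) j)) shared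
    where
    shared : ∀ {W} → W ∈ hyperedge v (push (f , u) i) → W ∈ hyperedge v (push (f′ , u′) j) → ⊥
    shared W∈ W∈′ with ∈-hyperedge-push v f u i W∈ | ∈-hyperedge-push v f′ u′ j W∈′
    ... | _ , _ , refl | _ , _ , refl = s≢ refl

  -- Tells to which root edge an item belongs. Items with different first edges can share no walk
  -- except the root `[]`.
  firstEdge : Item n → Subset n
  firstEdge ([]          , e) = e
  firstEdge ((f , _) ∷ _ , _) = f

  ∈-hyperedge-firstEdge : ∀ v i {f u W} → (f , u) ∷ W ∈ hyperedge v i → f ≡ firstEdge i
  ∈-hyperedge-firstEdge v ([] , e) W∈ with ∈-hyperedge-[] v e W∈
  ... | inj₂ (_ , refl) = refl
  ∈-hyperedge-firstEdge v ((f , u) ∷ W , e) W∈ with ∈-hyperedge-push v f u (W , e) W∈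
  ... | _ , _ , refl = refl

  tc-firstEdge : ∀ v f u i j → f ≢ firstEdge j → tc v (push (f , u) i) j ≡ true
  tc-firstEdge v f u i j f≢ = disjointᵇ⁺ decWalk (hyperedge v (push (f , u) i)) (hyperedge v j) shared
    where
    shared : ∀ {W} → W ∈ hyperedge v (push (f , u) i) → W ∈ hyperedge v j → ⊥
    shared W∈ W∈′ with ∈-hyperedge-push v f u i W∈
    ... | _ , _ , refl = f≢ (∈-hyperedge-firstEdge v j W∈′)

  tc-sym : ∀ v i j → tc v i j ≡ tc v j i
  tc-sym v i j = disjointᵇ-sym decWalk (hyperedge v i) (hyperedge v j)

  -- Only the walk `[]` could be shared, and it lies in the second hyperedge exactly when that one
  -- is attached at the root.
  tc-root-other : ∀ v e j → e ≢ firstEdge j → tc v ([] , e) j ≡ deep j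
  tc-root-other v e ([] , f) e≢ =
    disjointᵇ-false decWalk (hyperedge v ([] , e)) (hyperedge v ([] , f)) (here refl) (here refl)
  tc-root-other v e ((f , u) ∷ W , g) e≢ =
    trans (tc-sym v ([] , e) _) (tc-firstEdge v f u (W , g) ([] , e) (e≢ ∘ sym))

  -- The root hyperedge of e reaches into the branch of u only with the walk `[ (e , u) ]`, the root
  -- of that branch. Choosing it thus deletes the root of every branch below e and nothing else
  -- there.
  tc-root-push : ∀ v e u j → u Sub.∈ e → v ≢ u → tc v ([] , e) (push (e , u) j) ≡ deep j
  tc-root-push v e u ([] , f) u∈e v≢u = disjointᵇ-false decWalk
    (hyperedge v ([] , e)) (hyperedge v (push (e , u) ([] , f)))
    (there (∈-map⁺ (λ u → [ (e , u) ]) (∈-remove⁺ decFin v≢u (∈-subsetToList⁺ u∈e)))) (here refl)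
  tc-root-push v e u ((f , u′) ∷ W , g) u∈e v≢u =
    disjointᵇ⁺ decWalk (hyperedge v ([] , e)) (hyperedge v (push (e , u) ((f , u′) ∷ W , g))) shared
    where
    shared : ∀ {W′} → W′ ∈ hyperedge v ([] , e) →
      W′ ∈ hyperedge v (push (e , u) ((f , u′) ∷ W , g)) → ⊥
    shared W∈ W∈′ with ∈-hyperedge-push v e u ((f , u′) ∷ W , g) W∈′
    ... | V , V∈ , refl with ∈-hyperedge-push u f u′ (W , g) V∈
    ...   | _ , _ , refl with ∈-hyperedge-[] v e W∈
    ...     | inj₁ ()
    ...     | inj₂ (_ , ())

-- Recursive enumeration of the hyperedges

module Tree {n : ℕ} (E : List (Subset n)) (rank : Fin n → ℕ) (order : List (Fin n)) where

  children : Fin n → Subset n → List (Fin n)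
  children v e = filterᵇ (λ u → does (u ∈? e) ∧ not (does (decFin v u))) order

  ∈-children⁻ : ∀ v e {u} → u ∈ children v e → u Sub.∈ e × v ≢ u
  ∈-children⁻ v e {u} u∈ =
    let _ , q = ∈-filterᵇ⁻ _ order u∈
        a , b = ∧-true {does (u ∈? e)} q
    in does⁻ (u ∈? e) a , not-does⁻ (decFin v u) b

  ∈-children⁺ : (∀ u → u ∈ order) → ∀ v e {u} → u Sub.∈ e → v ≢ u → u ∈ children v e
  ∈-children⁺ complete v e {u} u∈ v≢u = ∈-filterᵇ⁺ _ (complete u)
    (cong₂ _∧_ (does⁺ (u ∈? e) u∈) (not-does⁺ (decFin v u) v≢u))

  admissible : Fin n → Subset n → Subset n → Bool
  admissible v C e = does (v ∈? e) ∧ dis C e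

  admissible⁻ : ∀ v C e → admissible v C e ≡ true → v Sub.∈ e × (∀ {x} → x Sub.∈ C → x Sub.∈ e → ⊥)
  admissible⁻ v C e a = let p , q = ∧-true {does (v ∈? e)} a in does⁻ (v ∈? e) p , dis⁻ C e q

  block : (Fin n → Subset n → List (Item n)) → Fin n → Subset n → Subset n → List (Item n)
  block sub v C e = ([] , e) ∷
    concatMap (λ u → map (push (e , u)) (sub u (C ∪ Cset rank v e u))) (children v e)

  -- The hyperedges of the subtree of walks continuing from v while avoiding C,
  -- for walks of length less than the first argument.
  tree : ℕ → Fin n → Subset n → List (Item n)
  tree zero    v C = []
  tree (suc m) v C = concatMap (block (tree m) v C) (filterᵇ (admissible v C) E)

  module _ (sub : Fin n → Subset n → List (Item n)) (v : Fin n) (C : Subset n) where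

    branches : Subset n → List (Item n)
    branches e = concatMap (λ u → map (push (e , u)) (sub u (C ∪ Cset rank v e u))) (children v e)

    ∈-branches⁻ : ∀ e {i} → i ∈ branches e →
      ∃ λ u → u ∈ children v e × ∃ λ j → j ∈ sub u (C ∪ Cset rank v e u) × i ≡ push (e , u) j
    ∈-branches⁻ e i∈ =
      let u , u∈ , i∈′ = ∈-concatMap⁻′ _ (children v e) i∈
      in u , u∈ , ∈-map⁻ (push (e , u)) i∈′

    block-firstEdge : ∀ e {i} → i ∈ block sub v C e → firstEdge i ≡ e
    block-firstEdge e (here refl) = refl
    block-firstEdge e (there i∈) with ∈-branches⁻ e i∈
    ... | _ , _ , _ , _ , refl = refl

  -- Leaving v puts v into the forbidden set, so each unit of fuel spent is repaid by a new element
  -- of C. The invariant is that the fuel covers the vertices outside C.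
  grow : ∀ {v C e u m} → ¬ v Sub.∈ C → n ≤ suc m ℕ.+ ∣ C ∣ → n ≤ m ℕ.+ ∣ C ∪ Cset rank v e u ∣
  grow {v} {C} {e} {u} {m} v∉C le = ℕP.≤-trans le (ℕP.≤-trans
    (ℕP.≤-reflexive (sym (ℕP.+-suc m ∣ C ∣)))
    (ℕP.+-monoʳ-≤ m (SP.p⊂q⇒∣p∣<∣q∣
      (SP.p⊆p∪q (Cset rank v e u) , v , SP.q⊆p∪q C _ (∈-Cset⁺ʳ rank {e = e} {u = u}) , v∉C))))

  -- A root outside C leaves C with fewer than n elements, so the invariant of `grow` excludes zero
  -- fuel: the depth bound never cuts the tree off.
  no-fuel : ∀ {v C} → ¬ v Sub.∈ C → ¬ n ≤ ∣ C ∣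
  no-fuel {v} {C} v∉C le = ℕP.<⇒≱ (SP.p⊂q⇒∣p∣<∣q∣ {p = C} {q = C ∪ ⁅ v ⁆}
    (SP.p⊆p∪q ⁅ v ⁆ , v , SP.q⊆p∪q C ⁅ v ⁆ (SP.x∈⁅x⁆ v) , v∉C))
    (ℕP.≤-trans (SP.∣p∣≤n (C ∪ ⁅ v ⁆)) le)

  -- Keeps the root outside the forbidden set along the recursion; u is not forbidden by its own
  -- step because ≺ is strict.
  fresh : ∀ {v C e u} → (∀ {x} → x Sub.∈ C → x Sub.∈ e → ⊥) → u Sub.∈ e → v ≢ u →
    ¬ u Sub.∈ (C ∪ Cset rank v e u)
  fresh {v} {C} {e} {u} C#e u∈e v≢u u∈ with SP.x∈p∪q⁻ C _ u∈
  ... | inj₁ u∈C = C#e u∈C u∈e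
  ... | inj₂ u∈C with ∈-Cset⁻ rank u∈C
  ...   | inj₁ (_ , lt) = ℕP.<-irrefl refl lt
  ...   | inj₂ u≡v      = v≢u (sym u≡v)

  -- Membership in `tree` freed from the depth bound, in a form that can be compared with
  -- conflict-free walks.
  Extends : Subset n → Fin n → Walk n → Subset n → Set
  Extends C v []            f = f ∈ E × admissible v C f ≡ true
  Extends C v ((e , u) ∷ W) f =
    (e ∈ E × admissible v C e ≡ true) × (u Sub.∈ e × v ≢ u) × Extends (C ∪ Cset rank v e u) u W f

  tree⁻ : ∀ m {v C W f} → (W , f) ∈ tree m v C → Extends C v W f
  tree⁻ (suc m) {v} {C} i∈ with ∈-concatMap⁻′ (block (tree m) v C) (filterᵇ (admissible v C) E) i∈
  ... | e , e∈ , here refl = ∈-filterᵇ⁻ _ E e∈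
  ... | e , e∈ , there i∈′ with ∈-branches⁻ (tree m) v C e i∈′
  ...   | u , u∈ , _ , j∈ , refl = ∈-filterᵇ⁻ _ E e∈ , ∈-children⁻ v e u∈ , tree⁻ m j∈

  tree⁺ : (∀ u → u ∈ order) → ∀ m {v C} W {f} → ¬ v Sub.∈ C → n ≤ m ℕ.+ ∣ C ∣ →
    Extends C v W f → (W , f) ∈ tree m v C
  tree⁺ complete zero    W  v∉C le x = ⊥-elim (no-fuel v∉C le)
  tree⁺ complete (suc m) [] v∉C le (f∈ , a) =
    ∈-concatMap⁺′ _ (∈-filterᵇ⁺ _ f∈ a) (here refl)
  tree⁺ complete (suc m) {v} {C} ((e , u) ∷ W) v∉C le ((e∈ , a) , (u∈e , v≢u) , x) =
    ∈-concatMap⁺′ (block (tree m) v C) (∈-filterᵇ⁺ _ e∈ a) (there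
      (∈-concatMap⁺′ (λ u → map (push (e , u)) (tree m u (C ∪ Cset rank v e u)))
        (∈-children⁺ complete v e u∈e v≢u)
        (∈-map⁺ (push (e , u)) (tree⁺ complete m W
          (fresh (proj₂ (admissible⁻ v C e a)) u∈e v≢u) (grow {e = e} {u} v∉C le) x))))

  -- A repeated item would be counted twice by `J`. Without repetitions, equal membership is enough
  -- to make this list a permutation of the items of the walk tree.
  tree-unique : Unique E → Unique order → ∀ m v C → Unique (tree m v C)
  tree-unique uE uO zero    v C = []
  tree-unique uE uO (suc m) v C = concatMap-unique (block (tree m) v C) _ (filterᵇ-unique _ uE)
    (λ e _ → All.tabulate (λ i∈ → root≢ e i∈) ∷ concatMap-unique _ (children v e) (filterᵇ-unique _ uO)
      (λ u _ → UP.map⁺ push-injective (tree-unique uE uO m u _))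
      λ u u′ u≢ i∈ i∈′ → apart e u≢ (∈-map⁻ _ i∈) (∈-map⁻ _ i∈′))
    λ e e′ e≢ i∈ i∈′ → e≢ (trans (sym (block-firstEdge (tree m) v C e i∈))
                                    (block-firstEdge (tree m) v C e′ i∈′))
    where
    root≢ : ∀ e {i} → i ∈ branches (tree m) v C e → ([] , e) ≢ i
    root≢ e i∈ p with ∈-branches⁻ (tree m) v C e i∈
    root≢ e i∈ () | _ , _ , _ , _ , refl
    apart : ∀ e {u u′} → u ≢ u′ → ∀ {i L L′} → ∃ (λ j → j ∈ L × i ≡ push (e , u) j) →
      ∃ (λ j → j ∈ L′ × i ≡ push (e , u′) j) → ⊥
    apart e u≢ (_ , _ , refl) (_ , _ , refl) = u≢ refl

  -- The identity between H and its walk tree, for series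

  module Identity (R : CommutativeSemiring 0ℓ 0ℓ) (w : CommutativeSemiring.Carrier R)
                  (uE : Unique E) (sorted : AllPairs (λ x y → rank x < rank y) order) where
    open CommutativeSemiring R
      renaming (refl to ≈-refl; sym to ≈-sym; trans to ≈-trans; reflexive to ≈-reflexive)
    open IndependenceSum R w
    open import Algebra.Solver.Ring.NaturalCoefficients.Default R
    open import Relation.Binary.Reasoning.Setoid setoid

    order-unique : Unique order
    order-unique = AllPairs.map (λ { lt refl → ℕP.<-irrefl refl lt }) sorted

    h : Subset n → Carrier
    h C = J dis (dis C) E

    h-cong : ∀ {C D} → (∀ {x} → x Sub.∈ C → x Sub.∈ D) → (∀ {x} → x Sub.∈ D → x Sub.∈ C) → h C ≈ h D
    h-cong C⊆D D⊆C = ≈-reflexive (cong h (SP.⊆-antisym C⊆D D⊆C))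

    -- Edges through v meet each other and themselves in v, hence form a clique for `J-clique`. Once
    -- e is chosen, the other edges have to avoid both C and e.
    h-expand : ∀ v C →
      h C ≈ h (C ∪ ⁅ v ⁆) + w * ∑ (λ e → h (C ∪ e)) (filterᵇ (admissible v C) E)
    h-expand v C = ≈-trans
      (J-clique (dis C) (λ e → does (v ∈? e)) dis-sym E λ x y _ _ v∈x v∈y →
        dis-false x y (does⁻ (v ∈? x) v∈x) (does⁻ (v ∈? y) v∈y))
      (+-cong
        (J-cong E λ e _ → sym (trans (dis-∪ C ⁅ v ⁆ e) (cong (dis C e ∧_) (dis-⁅⁆ v e))))
        (*-congˡ (≈-trans
          (∑-cong E λ e _ → if-cong {admissible v C e} refl (J-cong E λ f _ → sym (dis-∪ C e f)))
          (≈-sym (∑-filter (admissible v C) _ E)))))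

    -- D collects what is forbidden before the first entry of `us`, and F what is forbidden after
    -- the last. The sets S u and F are described by membership relative to D, so that the recursive
    -- call can move the head from the list into D.
    telescope : ∀ (a b : Fin n → Carrier) (S : Fin n → Subset n) us D F →
      AllPairs (λ x y → rank x < rank y) us →
      (∀ u → u ∈ us → a u * h (S u ∪ ⁅ u ⁆) ≈ b u * h (S u)) →
      (∀ u → u ∈ us → ∀ {x} → x Sub.∈ S u → x Sub.∈ D ⊎ (x ∈ us × rank x < rank u)) →
      (∀ u → u ∈ us → ∀ {x} → x Sub.∈ D ⊎ (x ∈ us × rank x < rank u) → x Sub.∈ S u) →
      (∀ {x} → x Sub.∈ F → x Sub.∈ D ⊎ x ∈ us) → (∀ {x} → x Sub.∈ D ⊎ x ∈ us → x Sub.∈ F) →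
      ∏ b us * h D ≈ ∏ a us * h F
    telescope a b S [] D F _ _ _ _ F⁻ F⁺ = *-congˡ (h-cong (F⁺ ∘ inj₁) λ x∈ → only-D (F⁻ x∈))
      where
      only-D : ∀ {x} → x Sub.∈ D ⊎ x ∈ [] → x Sub.∈ D
      only-D (inj₁ x∈) = x∈
    telescope a b S (u ∷ us) D F (u< ∷ us<) ab S⁻ S⁺ F⁻ F⁺ = begin
      (b u * ∏ b us) * h D                ≈⟨ *-congˡ (h-cong (S⁺ u (here refl) ∘ inj₁)
                                               λ x∈ → first (S⁻ u (here refl) x∈)) ⟩
      (b u * ∏ b us) * h (S u)            ≈⟨ solve 3 (λ x y z → (x :* y) :* z := y :* (x :* z)) ≈-refl _ _ _ ⟩
      ∏ b us * (b u * h (S u))            ≈⟨ *-congˡ (≈-sym (ab u (here refl))) ⟩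
      ∏ b us * (a u * h (S u ∪ ⁅ u ⁆))    ≈⟨ *-congˡ (*-congˡ (h-cong
                                               (add-u (λ x∈ → first (S⁻ u (here refl) x∈)))
                                               (add-u (S⁺ u (here refl) ∘ inj₁)))) ⟩
      ∏ b us * (a u * h (D ∪ ⁅ u ⁆))      ≈⟨ solve 3 (λ x y z → y :* (x :* z) := x :* (y :* z)) ≈-refl _ _ _ ⟩
      a u * (∏ b us * h (D ∪ ⁅ u ⁆))      ≈⟨ *-congˡ (telescope a b S us (D ∪ ⁅ u ⁆) F us<
                                               (λ y y∈ → ab y (there y∈))
                                               (λ y y∈ x∈ → S⁻′ y∈ (S⁻ y (there y∈) x∈))
                                               (λ y y∈ x∈ → S⁺ y (there y∈) (S⁺′ y∈ x∈))
                                               (λ x∈ → F⁻′ (F⁻ x∈)) (λ x∈ → F⁺ (F⁺′ x∈))) ⟩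
      a u * (∏ a us * h F)                ≈⟨ ≈-sym (*-assoc _ _ _) ⟩
      (a u * ∏ a us) * h F ∎
      where
      -- Nothing in the increasing list ranks below its head, so the set S of the head is D itself.
      first : ∀ {x} → x Sub.∈ D ⊎ (x ∈ u ∷ us × rank x < rank u) → x Sub.∈ D
      first (inj₁ x∈)                = x∈
      first (inj₂ (here refl , lt)) = ⊥-elim (ℕP.<-irrefl refl lt)
      first (inj₂ (there x∈ , lt))    = ⊥-elim (ℕP.<-asym lt (All.lookup u< x∈))
      add-u : ∀ {P Q : Subset n} → (∀ {x} → x Sub.∈ P → x Sub.∈ Q) →
        ∀ {x} → x Sub.∈ (P ∪ ⁅ u ⁆) → x Sub.∈ (Q ∪ ⁅ u ⁆)
      add-u {P} {Q} P⊆Q x∈ with SP.x∈p∪q⁻ P ⁅ u ⁆ x∈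
      ... | inj₁ x∈P = SP.p⊆p∪q ⁅ u ⁆ (P⊆Q x∈P)
      ... | inj₂ x∈u = SP.q⊆p∪q Q ⁅ u ⁆ x∈u
      D+u⁻ : ∀ {x} → x Sub.∈ (D ∪ ⁅ u ⁆) → x Sub.∈ D ⊎ x ≡ u
      D+u⁻ x∈ with SP.x∈p∪q⁻ D ⁅ u ⁆ x∈
      ... | inj₁ x∈D = inj₁ x∈D
      ... | inj₂ x∈u = inj₂ (SP.x∈⁅y⁆⇒x≡y u x∈u)
      D⊆ : ∀ {x} → x Sub.∈ D → x Sub.∈ (D ∪ ⁅ u ⁆)
      D⊆ = SP.p⊆p∪q ⁅ u ⁆
      u∈D+u : u Sub.∈ (D ∪ ⁅ u ⁆)
      u∈D+u = SP.q⊆p∪q D ⁅ u ⁆ (SP.x∈⁅x⁆ u)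
      S⁻′ : ∀ {x y} → y ∈ us → x Sub.∈ D ⊎ (x ∈ u ∷ us × rank x < rank y) →
        x Sub.∈ (D ∪ ⁅ u ⁆) ⊎ (x ∈ us × rank x < rank y)
      S⁻′ y∈ (inj₁ x∈)                 = inj₁ (D⊆ x∈)
      S⁻′ y∈ (inj₂ (here refl , lt)) = inj₁ u∈D+u
      S⁻′ y∈ (inj₂ (there x∈ , lt))    = inj₂ (x∈ , lt)
      S⁺′ : ∀ {x y} → y ∈ us → x Sub.∈ (D ∪ ⁅ u ⁆) ⊎ (x ∈ us × rank x < rank y) →
        x Sub.∈ D ⊎ (x ∈ u ∷ us × rank x < rank y)
      S⁺′ y∈ (inj₂ (x∈ , lt)) = inj₂ (there x∈ , lt)
      S⁺′ y∈ (inj₁ x∈) with D+u⁻ x∈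
      ... | inj₁ x∈D    = inj₁ x∈D
      ... | inj₂ refl = inj₂ (here refl , All.lookup u< y∈)
      F⁻′ : ∀ {x} → x Sub.∈ D ⊎ x ∈ u ∷ us → x Sub.∈ (D ∪ ⁅ u ⁆) ⊎ x ∈ us
      F⁻′ (inj₁ x∈)            = inj₁ (D⊆ x∈)
      F⁻′ (inj₂ (here refl)) = inj₁ u∈D+u
      F⁻′ (inj₂ (there x∈))    = inj₂ x∈
      F⁺′ : ∀ {x} → x Sub.∈ (D ∪ ⁅ u ⁆) ⊎ x ∈ us → x Sub.∈ D ⊎ x ∈ u ∷ us
      F⁺′ (inj₂ x∈) = inj₂ (there x∈)
      F⁺′ (inj₁ x∈) with D+u⁻ x∈
      ... | inj₁ x∈D    = inj₁ x∈D
      ... | inj₂ refl = inj₂ (here refl)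

    t t° : ℕ → Fin n → Subset n → Carrier
    t  m v C = J (tc v) (λ _ → true) (tree m v C)
    t° m v C = J (tc v) deep (tree m v C)

    module Step (m : ℕ) (v : Fin n) (C : Subset n) where

      S : Subset n → Fin n → Subset n
      S e u = C ∪ Cset rank v e u

      -- Branches of different children share no walk, so the series factors over the children. The
      -- pair p, q translates a condition in the large tree into one in each branch: compatibility
      -- with the root hyperedge of e becomes `deep`, while `deep` itself becomes no condition at
      -- all.
      J-branches : ∀ (p q : Item n → Bool) e →
        (∀ u → u ∈ children v e → ∀ j → p (push (e , u) j) ≡ q j) →
        J (tc v) p (branches (tree m) v C e) ≈ ∏ (λ u → J (tc u) q (tree m u (S e u))) (children v e)
      J-branches p q e pq = ≈-trans
        (J-concatMap _ (children v e) (filterᵇ-unique _ order-unique)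
          λ u u′ u≢ i j i∈ j∈ → apart e u≢ (∈-map⁻ _ i∈) (∈-map⁻ _ j∈))
        (∏-cong (children v e) λ u u∈ → ≈-trans
          (J-map (push (e , u)) (tree m u (S e u)) λ i j _ _ → tc-push v e u i j)
          (J-cong (tree m u (S e u)) λ j _ → pq u u∈ j))
        where
        apart : ∀ e {u u′} → u ≢ u′ → ∀ {i i′ L L′} → ∃ (λ j → j ∈ L × i ≡ push (e , u) j) →
          ∃ (λ j → j ∈ L′ × i′ ≡ push (e , u′) j) → tc v i i′ ≡ true
        apart e u≢ (j , _ , refl) (j′ , _ , refl) =
          tc-push-≢ v j j′ λ { refl → u≢ refl }

      P P° : Subset n → Carrier
      P  e = ∏ (λ u → t  m u (S e u)) (children v e)
      P° e = ∏ (λ u → t° m u (S e u)) (children v e)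

      blocks : List (Subset n) → List (Item n)
      blocks = concatMap (block (tree m) v C)

      ∈-blocks : ∀ {e} es → All (e ≢_) es → ∀ {j} → j ∈ blocks es → e ≢ firstEdge j
      ∈-blocks es e∉ j∈ e≡ =
        let f , f∈ , j∈f = ∈-concatMap⁻′ (block (tree m) v C) es j∈
        in All.lookup e∉ f∈ (trans e≡ (block-firstEdge (tree m) v C f j∈f))

      J-branches++blocks : ∀ p e es → All (e ≢_) es →
        J (tc v) p (branches (tree m) v C e ++ blocks es)
          ≈ J (tc v) p (branches (tree m) v C e) * J (tc v) p (blocks es)
      J-branches++blocks p e es e∉ = J-++ _ (blocks es) λ i j i∈ j∈ →
        apart (∈-branches⁻ (tree m) v C e i∈) (∈-blocks es e∉ j∈)
        where
        apart : ∀ {i j L} {S′ : Fin n → List (Item n)} →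
          ∃ (λ u → u ∈ L × ∃ λ j′ → j′ ∈ S′ u × i ≡ push (e , u) j′) →
          e ≢ firstEdge j → tc v i j ≡ true
        apart (u , _ , j′ , _ , refl) e≢ = tc-firstEdge v e u j′ _ e≢

      -- All root hyperedges contain the root, so at most one is chosen. Choosing that of e turns
      -- its factor `P e` into `P° e` and leaves only the deep items of the other blocks. The
      -- hypothesis then trades `P° e * hv` for `P e * he e`, so the factor `P e` is restored in
      -- every term and nothing has to be cancelled.
      blocks-identity : (hv : Carrier) (he : Subset n → Carrier) → ∀ es → Unique es →
        (∀ e → e ∈ es → P° e * hv ≈ P e * he e) →
        J (tc v) (λ _ → true) (blocks es) * hv
          ≈ J (tc v) deep (blocks es) * (hv + w * ∑ he es)
      blocks-identity hv he [] _ _ =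
        solve 2 (λ x w → con 1 :* x := con 1 :* (x :+ w :* con 0)) ≈-refl hv w
      blocks-identity hv he (e ∷ es) (e∉ ∷ u) H = begin
        J (tc v) (λ _ → true) (blocks (e ∷ es)) * hv
          ≈⟨ *-congʳ (+-cong
               (≈-trans (J-branches++blocks _ e es e∉) (*-congʳ (J-branches _ (λ _ → true) e λ _ _ _ → refl)))
               (*-congˡ (≈-trans (J-branches++blocks _ e es e∉)
                 (*-cong (J-branches _ deep e λ u u∈ j → let u∈e , v≢u = ∈-children⁻ v e u∈ in
                            tc-root-push v e u j u∈e v≢u)
                         (J-cong (blocks es) λ j j∈ → tc-root-other v e j (∈-blocks es e∉ j∈)))))) ⟩
        (P e * A + w * (P° e * B)) * hv
          ≈⟨ solve 6 (λ p a w q b x → (p :* a :+ w :* (q :* b)) :* x := p :* (a :* x) :+ (w :* b) :* (q :* x))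
               ≈-refl _ _ _ _ _ _ ⟩
        P e * (A * hv) + (w * B) * (P° e * hv)
          ≈⟨ +-cong (*-congˡ (blocks-identity hv he es u λ f f∈ → H f (there f∈)))
                    (*-congˡ (H e (here refl))) ⟩
        P e * (B * (hv + w * ∑ he es)) + (w * B) * (P e * he e)
          ≈⟨ solve 6 (λ p b x w s y → p :* (b :* (x :+ w :* s)) :+ (w :* b) :* (p :* y)
                       := (p :* b) :* (x :+ w :* (y :+ s))) ≈-refl _ _ _ _ _ _ ⟩
        (P e * B) * (hv + w * ∑ he (e ∷ es))
          -- Of the block of e, `deep` rejects the root hyperedge alone: every pushed item is deep,
          -- so the branches contribute the full product `P e`.
          ≈⟨ *-congʳ (≈-sym (≈-trans (+-identityʳ _) (≈-trans (J-branches++blocks _ e es e∉)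
               (*-congʳ (J-branches deep (λ _ → true) e λ _ _ _ → refl))))) ⟩
        J (tc v) deep (blocks (e ∷ es)) * (hv + w * ∑ he (e ∷ es)) ∎
        where
        A B : Carrier
        A = J (tc v) (λ _ → true) (blocks es)
        B = J (tc v) deep (blocks es)

    tree-identity : (∀ u → u ∈ order) → ∀ m v C → ¬ v Sub.∈ C → n ≤ m ℕ.+ ∣ C ∣ →
      t m v C * h (C ∪ ⁅ v ⁆) ≈ t° m v C * h C
    tree-identity complete zero    v C v∉C le = ⊥-elim (no-fuel v∉C le)
    tree-identity complete (suc m) v C v∉C le = ≈-trans
      (blocks-identity (h (C ∪ ⁅ v ⁆)) (λ e → h (C ∪ e)) _ (filterᵇ-unique _ uE) edge-identity)
      (*-congˡ (≈-sym (h-expand v C)))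
      where
      open Step m v C
      edge-identity : ∀ e → e ∈ filterᵇ (admissible v C) E →
        P° e * h (C ∪ ⁅ v ⁆) ≈ P e * h (C ∪ e)
      edge-identity e e∈ = telescope (λ u → t m u (S e u)) (λ u → t° m u (S e u)) (S e)
        (children v e) (C ∪ ⁅ v ⁆) (C ∪ e) (AP.filter⁺ (λ x → BP.T? _) sorted)
        (λ u u∈ → let u∈e , v≢u = ∈-children⁻ v e u∈ in
          tree-identity complete m u (S e u) (fresh C#e u∈e v≢u) (grow {e = e} {u} v∉C le))
        (λ u u∈ x∈ → S⁻ u (SP.x∈p∪q⁻ C _ x∈)) (λ u u∈ x∈ → S⁺ u x∈)
        (λ x∈ → F⁻ (SP.x∈p∪q⁻ C e x∈)) F⁺
        where
        a : v Sub.∈ e × (∀ {x} → x Sub.∈ C → x Sub.∈ e → ⊥)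
        a = admissible⁻ v C e (proj₂ (∈-filterᵇ⁻ _ E e∈))
        C#e : ∀ {x} → x Sub.∈ C → x Sub.∈ e → ⊥
        C#e = proj₂ a
        C+v : ∀ {x} → x Sub.∈ C → x Sub.∈ (C ∪ ⁅ v ⁆)
        C+v = SP.p⊆p∪q ⁅ v ⁆
        v∈C+v : v Sub.∈ (C ∪ ⁅ v ⁆)
        v∈C+v = SP.q⊆p∪q C ⁅ v ⁆ (SP.x∈⁅x⁆ v)
        S⁻ : ∀ u {x} → x Sub.∈ C ⊎ x Sub.∈ Cset rank v e u →
          x Sub.∈ (C ∪ ⁅ v ⁆) ⊎ (x ∈ children v e × rank x < rank u)
        S⁻ u (inj₁ x∈) = inj₁ (C+v x∈)
        S⁻ u {x} (inj₂ x∈) with ∈-Cset⁻ rank x∈ | decFin v x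
        ... | inj₂ refl     | _          = inj₁ v∈C+v
        -- The root v can itself rank below u. It is not a child, and is accounted for by the
        -- summand ⁅ v ⁆ instead.
        ... | inj₁ _          | yes refl = inj₁ v∈C+v
        ... | inj₁ (x∈e , lt) | no v≢x     = inj₂ (∈-children⁺ complete v e x∈e v≢x , lt)
        S⁺ : ∀ u {x} → x Sub.∈ (C ∪ ⁅ v ⁆) ⊎ (x ∈ children v e × rank x < rank u) → x Sub.∈ S e u
        S⁺ u (inj₂ (x∈ , lt)) = SP.q⊆p∪q C _ (∈-Cset⁺ˡ rank (proj₁ (∈-children⁻ v e x∈)) lt)
        S⁺ u (inj₁ x∈) with SP.x∈p∪q⁻ C ⁅ v ⁆ x∈
        ... | inj₁ x∈C = SP.p⊆p∪q _ x∈C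
        ... | inj₂ x∈v with SP.x∈⁅y⁆⇒x≡y v x∈v
        ...   | refl = SP.q⊆p∪q C _ (∈-Cset⁺ʳ rank {e = e} {u = u})
        F⁻ : ∀ {x} → x Sub.∈ C ⊎ x Sub.∈ e → x Sub.∈ (C ∪ ⁅ v ⁆) ⊎ x ∈ children v e
        F⁻ (inj₁ x∈) = inj₁ (C+v x∈)
        F⁻ {x} (inj₂ x∈) with decFin v x
        ... | yes refl = inj₁ v∈C+v
        ... | no v≢x     = inj₂ (∈-children⁺ complete v e x∈ v≢x)
        F⁺ : ∀ {x} → x Sub.∈ (C ∪ ⁅ v ⁆) ⊎ x ∈ children v e → x Sub.∈ (C ∪ e)
        F⁺ (inj₂ x∈) = SP.q⊆p∪q C e (proj₁ (∈-children⁻ v e x∈))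
        F⁺ (inj₁ x∈) with SP.x∈p∪q⁻ C ⁅ v ⁆ x∈
        ... | inj₁ x∈C = SP.p⊆p∪q e x∈C
        ... | inj₂ x∈v with SP.x∈⁅y⁆⇒x≡y v x∈v
        ...   | refl = SP.q⊆p∪q C e (proj₁ a)

open ≡-Reasoning

-- Formal power series

infix 4 _≗ₚ_
_≗ₚ_ : Poly → Poly → Set
f ≗ₚ g = ∀ j → f j ≡ g j

infixl 6 _⊕_
_⊕_ : Poly → Poly → Poly
(f ⊕ g) j = f j ℤ.+ g j

0ₚ 1ₚ : Poly
0ₚ j = 0ℤ
1ₚ zero    = 1ℤ
1ₚ (suc j) = 0ℤ

-- The Cauchy product in recursive form, peeling off the constant term of the
-- left factor; *ₚ≗⊛ identifies it with _*ₚ_.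
infixl 7 _⊛_
_⊛_ : Poly → Poly → Poly
(f ⊛ g) zero    = f 0 ℤ.* g 0
(f ⊛ g) (suc j) = f 0 ℤ.* g (suc j) ℤ.+ ((f ∘ suc) ⊛ g) j

⊛-cong : ∀ {f f′ g g′} → f ≗ₚ f′ → g ≗ₚ g′ → f ⊛ g ≗ₚ f′ ⊛ g′
⊛-cong p q zero    = cong₂ ℤ._*_ (p 0) (q 0)
⊛-cong p q (suc j) =
  cong₂ ℤ._+_ (cong₂ ℤ._*_ (p 0) (q (suc j))) (⊛-cong (p ∘ suc) q j)

⊛-distribʳ : ∀ h f g → (f ⊕ g) ⊛ h ≗ₚ f ⊛ h ⊕ g ⊛ h
⊛-distribʳ h f g zero    = ℤP.*-distribʳ-+ (h 0) (f 0) (g 0)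
⊛-distribʳ h f g (suc j)
  rewrite ⊛-distribʳ h (f ∘ suc) (g ∘ suc) j
  = lemma (f 0) (g 0) (h (suc j)) (((f ∘ suc) ⊛ h) j) (((g ∘ suc) ⊛ h) j)
  where
  lemma : ∀ a b c d e →
    (a ℤ.+ b) ℤ.* c ℤ.+ (d ℤ.+ e) ≡ (a ℤ.* c ℤ.+ d) ℤ.+ (b ℤ.* c ℤ.+ e)
  lemma = solve-∀

⊛-zeroˡ : ∀ g → 0ₚ ⊛ g ≗ₚ 0ₚ
⊛-zeroˡ g zero    = refl
⊛-zeroˡ g (suc j) rewrite ⊛-zeroˡ g j = refl

scale : ℤ → Poly → Poly
scale a f j = a ℤ.* f j

⊛-scaleˡ : ∀ a f g → scale a f ⊛ g ≗ₚ scale a (f ⊛ g)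
⊛-scaleˡ a f g zero    = ℤP.*-assoc a (f 0) (g 0)
⊛-scaleˡ a f g (suc j) rewrite ⊛-scaleˡ a (f ∘ suc) g j =
  lemma a (f 0) (g (suc j)) (((f ∘ suc) ⊛ g) j)
  where
  lemma : ∀ a b c d → a ℤ.* b ℤ.* c ℤ.+ a ℤ.* d ≡ a ℤ.* (b ℤ.* c ℤ.+ d)
  lemma = solve-∀

⊛-identityˡ : ∀ g → 1ₚ ⊛ g ≗ₚ g
⊛-identityˡ g zero    = ℤP.*-identityˡ (g 0)
⊛-identityˡ g (suc j) rewrite ⊛-zeroˡ g j =
  trans (ℤP.+-identityʳ _) (ℤP.*-identityˡ (g (suc j)))

-- The recursion of `⊛` peels its left factor only; this mirror image for the right factor is what
-- commutativity needs.
⊛-sucʳ : ∀ f g j → (f ⊛ g) (suc j) ≡ (f ⊛ (g ∘ suc)) j ℤ.+ f (suc j) ℤ.* g 0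
⊛-sucʳ f g zero    = refl
⊛-sucʳ f g (suc j) rewrite ⊛-sucʳ (f ∘ suc) g j = sym (ℤP.+-assoc (f 0 ℤ.* g (suc (suc j))) _ _)

⊛-comm : ∀ f g → f ⊛ g ≗ₚ g ⊛ f
⊛-comm f g zero    = ℤP.*-comm (f 0) (g 0)
⊛-comm f g (suc j) rewrite ⊛-comm (f ∘ suc) g j | ⊛-sucʳ g f j =
  lemma (f 0) (g (suc j)) ((g ⊛ (f ∘ suc)) j)
  where
  lemma : ∀ a b c → a ℤ.* b ℤ.+ c ≡ c ℤ.+ b ℤ.* a
  lemma = solve-∀

-- By definition, the tail of `f ⊛ g` is `scale (f 0) (g ∘ suc) ⊕ (f ∘ suc) ⊛ g`. Distributivity and
-- scaling thus reduce the claim to the tail of f.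
⊛-assoc : ∀ f g h → (f ⊛ g) ⊛ h ≗ₚ f ⊛ (g ⊛ h)
⊛-assoc f g h zero    = ℤP.*-assoc (f 0) (g 0) (h 0)
⊛-assoc f g h (suc j)
  rewrite ⊛-distribʳ h (scale (f 0) (g ∘ suc)) ((f ∘ suc) ⊛ g) j
        | ⊛-scaleˡ (f 0) (g ∘ suc) h j
        | ⊛-assoc (f ∘ suc) g h j
  = lemma (f 0) (g 0) (h (suc j)) (((g ∘ suc) ⊛ h) j) (((f ∘ suc) ⊛ (g ⊛ h)) j)
  where
  lemma : ∀ a b c d e →
    a ℤ.* b ℤ.* c ℤ.+ (a ℤ.* d ℤ.+ e) ≡ a ℤ.* (b ℤ.* c ℤ.+ d) ℤ.+ e
  lemma = solve-∀

Series : CommutativeSemiring 0ℓ 0ℓ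
Series = record
  { Carrier = Poly ; _≈_ = _≗ₚ_ ; _+_ = _⊕_ ; _*_ = _⊛_ ; 0# = 0ₚ ; 1# = 1ₚ
  ; isCommutativeSemiring = isCommutativeSemiringˡ (record
    { +-isCommutativeMonoid = record
      { isMonoid = record
        { isSemigroup = record
          { isMagma = record { isEquivalence = isEq ; ∙-cong = λ p q j → cong₂ ℤ._+_ (p j) (q j) }
          ; assoc = λ f g h j → ℤP.+-assoc (f j) (g j) (h j) }
        ; identity = (λ f j → ℤP.+-identityˡ (f j)) , (λ f j → ℤP.+-identityʳ (f j)) }
      ; comm = λ f g j → ℤP.+-comm (f j) (g j) }
    ; *-isCommutativeMonoid = record
      { isMonoid = record
        { isSemigroup = record
          { isMagma = record { isEquivalence = isEq ; ∙-cong = ⊛-cong }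
          ; assoc = ⊛-assoc }
        ; identity = ⊛-identityˡ
                   , (λ f j → trans (⊛-comm f 1ₚ j) (⊛-identityˡ f j)) }
      ; comm = ⊛-comm }
    ; distribʳ = ⊛-distribʳ
    ; zeroˡ = ⊛-zeroˡ })
  }
  where
  isEq : IsEquivalence _≗ₚ_
  isEq = record { refl = λ _ → refl ; sym = λ p j → sym (p j) ; trans = λ p q j → trans (p j) (q j) }

sum-upTo : (φ : ℕ → ℤ) → ∀ m →
  sumℤ (map φ (upTo (suc m))) ≡ φ 0 ℤ.+ sumℤ (map (φ ∘ suc) (upTo m))
sum-upTo φ m = cong (λ l → φ 0 ℤ.+ sumℤ l)
  (trans (LP.map-applyUpTo suc φ m) (sym (LP.map-upTo (φ ∘ suc) m)))

*ₚ≗⊛ : ∀ f g → f *ₚ g ≗ₚ f ⊛ g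
*ₚ≗⊛ f g zero    = ℤP.+-identityʳ _
*ₚ≗⊛ f g (suc j) = trans (sum-upTo (λ a → f a ℤ.* g (suc j ∸ a)) (suc j))
  (cong (ℤ._+_ (f 0 ℤ.* g (suc j))) (*ₚ≗⊛ (f ∘ suc) g j))

X : ℕ → Poly
X zero    j       = 1ₚ j
X (suc a) zero    = 0ℤ
X (suc a) (suc j) = X a j

X-sym : ∀ a j → X a j ≡ X j a
X-sym zero    zero    = refl
X-sym zero    (suc j) = refl
X-sym (suc a) zero    = refl
X-sym (suc a) (suc j) = X-sym a j

X-⊛ : ∀ a b → X a ⊛ X b ≗ₚ X (a ℕ.+ b)
X-⊛ zero    b j       = ⊛-identityˡ (X b) j
X-⊛ (suc a) b zero    = refl
X-⊛ (suc a) b (suc j) = trans (ℤP.+-identityˡ _) (X-⊛ a b j)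

scale-⊛-scale : ∀ a b f g → scale a f ⊛ scale b g ≗ₚ scale (a ℤ.* b) (f ⊛ g)
scale-⊛-scale a b f g j = begin
  (scale a f ⊛ scale b g) j      ≡⟨ ⊛-scaleˡ a f (scale b g) j ⟩
  a ℤ.* (f ⊛ scale b g) j        ≡⟨ cong (a ℤ.*_) (⊛-comm f (scale b g) j) ⟩
  a ℤ.* (scale b g ⊛ f) j        ≡⟨ cong (a ℤ.*_) (⊛-scaleˡ b g f j) ⟩
  a ℤ.* (b ℤ.* (g ⊛ f) j)        ≡⟨ cong (λ x → a ℤ.* (b ℤ.* x)) (⊛-comm g f j) ⟩
  a ℤ.* (b ℤ.* (f ⊛ g) j)        ≡⟨ sym (ℤP.*-assoc a b _) ⟩
  a ℤ.* b ℤ.* (f ⊛ g) j ∎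

⊛-distribˡ : ∀ h f g → h ⊛ (f ⊕ g) ≗ₚ h ⊛ f ⊕ h ⊛ g
⊛-distribˡ h f g j = begin
  (h ⊛ (f ⊕ g)) j           ≡⟨ ⊛-comm h (f ⊕ g) j ⟩
  ((f ⊕ g) ⊛ h) j           ≡⟨ ⊛-distribʳ h f g j ⟩
  (f ⊛ h) j ℤ.+ (g ⊛ h) j   ≡⟨ cong₂ ℤ._+_ (⊛-comm f h j) (⊛-comm g h j) ⟩
  (h ⊛ f) j ℤ.+ (h ⊛ g) j ∎

⊛-zeroʳ : ∀ g → g ⊛ 0ₚ ≗ₚ 0ₚ
⊛-zeroʳ g j = trans (⊛-comm g 0ₚ j) (⊛-zeroˡ g j)

sumℤ-cong : ∀ {φ ψ : ℕ → ℤ} l → (∀ i → φ i ≡ ψ i) → sumℤ (map φ l) ≡ sumℤ (map ψ l)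
sumℤ-cong l h = cong sumℤ (LP.map-cong h l)

sumℤ-0 : ∀ (l : List ℕ) → sumℤ (map (λ _ → 0ℤ) l) ≡ 0ℤ
sumℤ-0 []      = refl
sumℤ-0 (x ∷ l) = trans (ℤP.+-identityˡ _) (sumℤ-0 l)

sumℤ-+ : ∀ (φ ψ : ℕ → ℤ) l →
  sumℤ (map (λ i → φ i ℤ.+ ψ i) l) ≡ sumℤ (map φ l) ℤ.+ sumℤ (map ψ l)
sumℤ-+ φ ψ []      = refl
sumℤ-+ φ ψ (x ∷ l) rewrite sumℤ-+ φ ψ l = lemma (φ x) (ψ x) (sumℤ (map φ l)) (sumℤ (map ψ l))
  where
  lemma : ∀ a b c d → (a ℤ.+ b) ℤ.+ (c ℤ.+ d) ≡ (a ℤ.+ c) ℤ.+ (b ℤ.+ d)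
  lemma = solve-∀

-- `X i j` is a Kronecker delta, so the sum selects the index j; the hypothesis deals with an index
-- beyond the range of summation.
sum-X : ∀ (f : Poly) m j → (m ≤ j → f j ≡ 0ℤ) →
  sumℤ (map (λ i → f i ℤ.* X i j) (upTo m)) ≡ f j
sum-X f zero    j       h = sym (h z≤n)
sum-X f (suc m) zero    h = begin
  sumℤ (map (λ i → f i ℤ.* X i 0) (upTo (suc m)))
    ≡⟨ sum-upTo (λ i → f i ℤ.* X i 0) m ⟩
  f 0 ℤ.* 1ℤ ℤ.+ sumℤ (map (λ i → f (suc i) ℤ.* 0ℤ) (upTo m))
    ≡⟨ cong₂ ℤ._+_ (ℤP.*-identityʳ (f 0))
         (trans (sumℤ-cong (upTo m) (λ i → ℤP.*-zeroʳ (f (suc i)))) (sumℤ-0 (upTo m))) ⟩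
  f 0 ℤ.+ 0ℤ
    ≡⟨ ℤP.+-identityʳ (f 0) ⟩
  f 0 ∎
sum-X f (suc m) (suc j) h = begin
  sumℤ (map (λ i → f i ℤ.* X i (suc j)) (upTo (suc m)))
    ≡⟨ sum-upTo (λ i → f i ℤ.* X i (suc j)) m ⟩
  f 0 ℤ.* 0ℤ ℤ.+ sumℤ (map (λ i → f (suc i) ℤ.* X i j) (upTo m))
    ≡⟨ cong₂ ℤ._+_ (ℤP.*-zeroʳ (f 0)) (sum-X (f ∘ suc) m j (h ∘ s≤s)) ⟩
  0ℤ ℤ.+ f (suc j)
    ≡⟨ ℤP.+-identityˡ _ ⟩
  f (suc j) ∎

≡ᵇ-shift : ∀ m {n} a j → m ℕ.+ a ≡ n → (m ℕ.+ j ≡ᵇ n) ≡ (a ≡ᵇ j)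
≡ᵇ-shift zero    zero    zero    refl = refl
≡ᵇ-shift zero    zero    (suc j) refl = refl
≡ᵇ-shift zero    (suc a) zero    refl = refl
≡ᵇ-shift zero    (suc a) (suc j) refl = ≡ᵇ-shift zero a j refl
≡ᵇ-shift (suc m) a       j       refl = ≡ᵇ-shift m a j refl

*-X : ∀ c a j → c ℤ.* X a j ≡ (if a ≡ᵇ j then c else 0ℤ)
*-X c zero    zero    = ℤP.*-identityʳ c
*-X c zero    (suc j) = ℤP.*-zeroʳ c
*-X c (suc a) zero    = ℤP.*-zeroʳ c
*-X c (suc a) (suc j) = *-X c a j

if-+ : ∀ b x y → (if b then x ℤ.+ y else 0ℤ) ≡ (if b then x else 0ℤ) ℤ.+ (if b then y else 0ℤ)
if-+ true  x y = refl
if-+ false x y = refl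

if-*ʳ : ∀ b c x → (if b then c ℤ.* x else 0ℤ) ≡ (if b then c else 0ℤ) ℤ.* x
if-*ʳ true  c x = refl
if-*ʳ false c x = refl

if-0 : ∀ b → (if b then 0ℤ else 0ℤ) ≡ 0ℤ
if-0 true  = refl
if-0 false = refl

-- From series in Y back to polynomials in x

module Reversal (k : ℕ) .{{_ : NonZero k}} where

  -- x^N f(x^{-k}), truncated to nonnegative exponents of x.
  rev : ℕ → Poly → Poly
  rev N f j = sumℤ (map (λ i → if (k ℕ.* i ℕ.+ j) ≡ᵇ N then f i else + 0) (upTo (suc N)))

  rev-cong : ∀ N {f g} → f ≗ₚ g → rev N f ≗ₚ rev N g
  rev-cong N h j = sumℤ-cong (upTo (suc N)) λ i →
    cong (λ x → if (k ℕ.* i ℕ.+ j) ≡ᵇ N then x else + 0) (h i)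

  -- Pairs a series in Y with its reversal monomial by monomial, which makes multiplicativity a
  -- matter of bilinearity and adding exponents. Series are functions compared pointwise, so `conv`
  -- closes the relation under that equality.
  data Reverses (N : ℕ) : Poly → Poly → Set where
    nil  : Reverses N 0ₚ 0ₚ
    mono : ∀ c i a → k ℕ.* i ℕ.+ a ≡ N → Reverses N (scale c (X i)) (scale c (X a))
    add  : ∀ {f F g G} → Reverses N f F → Reverses N g G → Reverses N (f ⊕ g) (F ⊕ G)
    conv : ∀ {f F f′ F′} → f ≗ₚ f′ → F ≗ₚ F′ → Reverses N f F → Reverses N f′ F′

  reverses-⊛ : ∀ {N N′ f F g G} → Reverses N f F → Reverses N′ g G →
    Reverses (N ℕ.+ N′) (f ⊛ g) (F ⊛ G)
  reverses-⊛ {g = g} {G} nil s =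
    conv (λ j → sym (⊛-zeroˡ g j)) (λ j → sym (⊛-zeroˡ G j)) nil
  reverses-⊛ {g = g} {G} (add {f} {F} {f′} {F′} r r′) s =
    conv (λ j → sym (⊛-distribʳ g f f′ j)) (λ j → sym (⊛-distribʳ G F F′ j))
      (add (reverses-⊛ r s) (reverses-⊛ r′ s))
  reverses-⊛ (conv p q r) s =
    conv (⊛-cong p λ _ → refl) (⊛-cong q λ _ → refl) (reverses-⊛ r s)
  reverses-⊛ {f = f} {F} (mono _ _ _ _) nil =
    conv (λ j → sym (⊛-zeroʳ f j)) (λ j → sym (⊛-zeroʳ F j)) nil
  reverses-⊛ {f = f} {F} r@(mono _ _ _ _) (add {g} {G} {g′} {G′} s s′) =
    conv (λ j → sym (⊛-distribˡ f g g′ j)) (λ j → sym (⊛-distribˡ F G G′ j))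
      (add (reverses-⊛ r s) (reverses-⊛ r s′))
  reverses-⊛ {f = f} {F} r@(mono _ _ _ _) (conv p q s) =
    conv (⊛-cong {f} (λ _ → refl) p) (⊛-cong {F} (λ _ → refl) q) (reverses-⊛ r s)
  reverses-⊛ (mono c i a e) (mono c′ i′ a′ e′) =
    conv (prod i i′) (prod a a′) (mono (c ℤ.* c′) (i ℕ.+ i′) (a ℕ.+ a′) exponents)
    where
    prod : ∀ i i′ → scale (c ℤ.* c′) (X (i ℕ.+ i′)) ≗ₚ scale c (X i) ⊛ scale c′ (X i′)
    prod i i′ j = sym (trans (scale-⊛-scale c c′ (X i) (X i′) j)
      (cong (c ℤ.* c′ ℤ.*_) (X-⊛ i i′ j)))
    exponents : k ℕ.* (i ℕ.+ i′) ℕ.+ (a ℕ.+ a′) ≡ _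
    exponents = trans (cong (ℕ._+ (a ℕ.+ a′)) (ℕP.*-distribˡ-+ k i i′))
      (trans (interchange ℕP.+-commutativeSemigroup (k ℕ.* i) (k ℕ.* i′) a a′) (cong₂ ℕ._+_ e e′))

  reverses⇒rev : ∀ {N f F} → Reverses N f F → F ≗ₚ rev N f
  reverses⇒rev {N} nil j = sym (trans
    (sumℤ-cong (upTo (suc N)) (λ i → if-0 (k ℕ.* i ℕ.+ j ≡ᵇ N))) (sumℤ-0 (upTo (suc N))))
  reverses⇒rev {N} (add {f} {F} {g} {G} r s) j = begin
    F j ℤ.+ G j                 ≡⟨ cong₂ ℤ._+_ (reverses⇒rev r j) (reverses⇒rev s j) ⟩
    rev N f j ℤ.+ rev N g j     ≡⟨ sym (sumℤ-+ (λ i → if k ℕ.* i ℕ.+ j ≡ᵇ N then f i else + 0)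
                                            (λ i → if k ℕ.* i ℕ.+ j ≡ᵇ N then g i else + 0) (upTo (suc N))) ⟩
    _                           ≡⟨ sumℤ-cong (upTo (suc N)) (λ i → sym (if-+ (k ℕ.* i ℕ.+ j ≡ᵇ N) (f i) (g i))) ⟩
    rev N (f ⊕ g) j ∎
  reverses⇒rev {N} (conv p q r) j = trans (sym (q j)) (trans (reverses⇒rev r j) (rev-cong N p j))
  reverses⇒rev {N} (mono c i a e) j = sym (begin
    rev N (scale c (X i)) j
      -- The sum runs over the argument of the monomial `X i`. Exchanging the two indices of the
      -- delta brings it into the form of `sum-X`.
      ≡⟨ sumℤ-cong (upTo (suc N)) (λ s → trans (if-*ʳ (k ℕ.* s ℕ.+ j ≡ᵇ N) c (X i s))
           (cong (coeff s ℤ.*_) (X-sym i s))) ⟩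
    sumℤ (map (λ s → coeff s ℤ.* X s i) (upTo (suc N)))
      ≡⟨ sum-X coeff (suc N) i (λ N<i → ⊥-elim (ℕP.<⇒≱ N<i i≤N)) ⟩
    coeff i
      ≡⟨ cong (λ b → if b then c else 0ℤ) (≡ᵇ-shift (k ℕ.* i) a j e) ⟩
    (if a ≡ᵇ j then c else 0ℤ)
      ≡⟨ sym (*-X c a j) ⟩
    c ℤ.* X a j ∎)
    where
    coeff : Poly
    coeff s = if (k ℕ.* s ℕ.+ j) ≡ᵇ N then c else 0ℤ
    i≤N : i ≤ N
    i≤N = ℕP.≤-trans (ℕP.m≤n*m i k) (ℕP.≤-trans (ℕP.m≤m+n (k ℕ.* i) a) (ℕP.≤-reflexive e))

  -- States that `rev N` cuts off no nonzero term. A term lost in one factor could still matter in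
  -- the product, so `rev-⊛` asks this of both.
  Bounded : ℕ → Poly → Set
  Bounded N f = ∀ i → N < k ℕ.* i → f i ≡ 0ℤ

  reverses-rev : ∀ {N f} → Bounded N f → Reverses N f (rev N f)
  reverses-rev {N} {f} bd = conv expand (λ _ → refl) (monomials (upTo (suc N)))
    where
    expand : (λ j → sumℤ (map (λ i → f i ℤ.* X i j) (upTo (suc N)))) ≗ₚ f
    expand j = sum-X f (suc N) j λ N<j → bd j (ℕP.<-≤-trans N<j (ℕP.m≤n*m j k))
    monomials : ∀ l → Reverses N (λ j → sumℤ (map (λ i → f i ℤ.* X i j) l))
      (λ j → sumℤ (map (λ i → if (k ℕ.* i ℕ.+ j) ≡ᵇ N then f i else + 0) l))
    monomials []      = nil
    monomials (i ∷ l) = add monomial (monomials l)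
      where
      monomial : Reverses N (λ j → f i ℤ.* X i j)
        (λ j → if (k ℕ.* i ℕ.+ j) ≡ᵇ N then f i else + 0)
      monomial with k ℕ.* i ℕ.≤? N
      ... | yes ki≤N = conv (λ _ → refl)
        (λ j → trans (*-X (f i) (N ∸ k ℕ.* i) j) (cong (λ b → if b then f i else 0ℤ)
          (sym (≡ᵇ-shift (k ℕ.* i) (N ∸ k ℕ.* i) j (ℕP.m+[n∸m]≡n ki≤N)))))
        (mono (f i) i (N ∸ k ℕ.* i) (ℕP.m+[n∸m]≡n ki≤N))
      ... | no ki≰N rewrite bd i (ℕP.≰⇒> ki≰N) =
        conv (λ _ → refl) (λ j → sym (if-0 (k ℕ.* i ℕ.+ j ≡ᵇ N))) nil

  rev-⊛ : ∀ {N N′ f g} → Bounded N f → Bounded N′ g →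
    rev N f ⊛ rev N′ g ≗ₚ rev (N ℕ.+ N′) (f ⊛ g)
  rev-⊛ b b′ = reverses⇒rev (reverses-⊛ (reverses-rev b) (reverses-rev b′))

-Y : Poly
-Y = scale (ℤ.- 1ℤ) (X 1)

-Y⊛suc : ∀ f j → (-Y ⊛ f) (suc j) ≡ ℤ.- f j
-Y⊛suc f j = begin
  (-Y ⊛ f) (suc j)                      ≡⟨ ⊛-scaleˡ (ℤ.- 1ℤ) (X 1) f (suc j) ⟩
  ℤ.- 1ℤ ℤ.* (0ℤ ℤ.+ (1ₚ ⊛ f) j)        ≡⟨ ℤP.-1*i≡-i _ ⟩
  ℤ.- (0ℤ ℤ.+ (1ₚ ⊛ f) j)               ≡⟨ cong ℤ.-_ (trans (ℤP.+-identityˡ _) (⊛-identityˡ f j)) ⟩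
  ℤ.- f j ∎

open IndependenceSum Series -Y public

-- Matching numbers as coefficients of the series

count : {A : Set} → (A → Bool) → List A → ℕ
count q L = length (filterᵇ q L)

count-cong : ∀ {A : Set} {q r : A → Bool} → (∀ x → q x ≡ r x) → ∀ L → count q L ≡ count r L
count-cong h [] = refl
count-cong {q = q} {r} h (x ∷ L) with q x | r x | h x
... | true  | .true  | refl = cong suc (count-cong h L)
... | false | .false | refl = count-cong h L

count-false : ∀ {A : Set} (L : List A) → count (λ _ → false) L ≡ 0
count-false []      = refl
count-false (x ∷ L) = count-false L

count-map : ∀ {A B : Set} (q : B → Bool) (f : A → B) L → count q (map f L) ≡ count (q ∘ f) L
count-map q f [] = refl
count-map q f (x ∷ L) with q (f x)
... | true  = cong suc (count-map q f L)
... | false = count-map q f L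

count-++ : ∀ {A : Set} (q : A → Bool) L L′ → count q (L ++ L′) ≡ count q L ℕ.+ count q L′
count-++ q [] L′ = refl
count-++ q (x ∷ L) L′ with q x
... | true  = cong suc (count-++ q L L′)
... | false = count-++ q L L′

all-∧ : ∀ {A : Set} (p q : A → Bool) L → all p L ∧ all q L ≡ all (λ x → p x ∧ q x) L
all-∧ p q [] = refl
all-∧ p q (x ∷ L) with p x | q x
... | true  | true  = all-∧ p q L
... | true  | false = BP.∧-zeroʳ _
... | false | _     = refl

module _ {V : Set} (d : DecidableEquality V) where

  isMatching : (List V → Bool) → ℕ → List (List V) → Bool
  isMatching p i M = (length M ≡ᵇ i) ∧ (pwDisjointᵇ d M ∧ all p M)

  -- Sublists of `e ∷ L` are split by whether they use e. Using e raises the size by one, which the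
  -- weight `-Y` records as a shift with a change of sign. Disjointness from e is absorbed into the
  -- predicate, which is why p is arbitrary.
  J-coeff : ∀ p L i →
    J (disjointᵇ d) p L i ≡ sign i ℤ.* + count (isMatching p i) (sublists L)
  J-coeff p [] zero    = refl
  J-coeff p [] (suc i) = sym (ℤP.*-zeroʳ (sign (suc i)))
  J-coeff p (e ∷ L) i = begin
    J (disjointᵇ d) p L i ℤ.+ with-e i
      ≡⟨ cong₂ ℤ._+_ (J-coeff p L i) (with-e-coeff i) ⟩
    sign i ℤ.* + count (isMatching p i) (sublists L)
      ℤ.+ sign i ℤ.* + count (isMatching p i ∘ (e ∷_)) (sublists L)
      ≡⟨ sym (ℤP.*-distribˡ-+ (sign i) _ _) ⟩
    sign i ℤ.* + (count (isMatching p i) (sublists L)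
                   ℕ.+ count (isMatching p i ∘ (e ∷_)) (sublists L))
      ≡⟨ cong (λ x → sign i ℤ.* + x) (trans
             (ℕP.+-comm (count (isMatching p i) (sublists L))
               (count (isMatching p i ∘ (e ∷_)) (sublists L)))
           (trans (cong (ℕ._+ count (isMatching p i) (sublists L))
             (sym (count-map (isMatching p i) (e ∷_) (sublists L))))
             (sym (count-++ (isMatching p i) (map (e ∷_) (sublists L)) (sublists L))))) ⟩
    sign i ℤ.* + count (isMatching p i) (sublists (e ∷ L)) ∎
    where
    p-e : List V → Bool
    p-e x = p x ∧ disjointᵇ d e x
    with-e : Poly
    with-e = if p e then -Y ⊛ J (disjointᵇ d) p-e L else 0ₚ
    pred : ∀ i M → p e ≡ true → isMatching p (suc i) (e ∷ M) ≡ isMatching p-e i M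
    pred i M pe rewrite pe with length M ≡ᵇ i
    ... | false = refl
    ... | true  = begin
      (all (disjointᵇ d e) M ∧ pwDisjointᵇ d M) ∧ all p M
        ≡⟨ cong (_∧ all p M) (BP.∧-comm _ (pwDisjointᵇ d M)) ⟩
      (pwDisjointᵇ d M ∧ all (disjointᵇ d e) M) ∧ all p M
        ≡⟨ BP.∧-assoc (pwDisjointᵇ d M) _ _ ⟩
      pwDisjointᵇ d M ∧ (all (disjointᵇ d e) M ∧ all p M)
        ≡⟨ cong (pwDisjointᵇ d M ∧_) (trans
           (BP.∧-comm (all (disjointᵇ d e) M) (all p M)) (all-∧ p (disjointᵇ d e) M)) ⟩
      pwDisjointᵇ d M ∧ all p-e M ∎
    with-e-coeff : ∀ i →
      with-e i ≡ sign i ℤ.* + count (isMatching p i ∘ (e ∷_)) (sublists L)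
    -- A sublist using e has positive size, and a multiple of `-Y` has no constant term.
    with-e-coeff zero with p e
    ... | true  = cong (λ x → 1ℤ ℤ.* + x) (sym (count-false (sublists L)))
    ... | false = cong (λ x → 1ℤ ℤ.* + x) (sym (count-false (sublists L)))
    with-e-coeff (suc i) = go (p e) refl
      where
      go : ∀ b → p e ≡ b →
        with-e (suc i) ≡ sign (suc i) ℤ.* + count (isMatching p (suc i) ∘ (e ∷_)) (sublists L)
      go true pe = begin
        with-e (suc i)
          ≡⟨ cong (λ b → (if b then -Y ⊛ J (disjointᵇ d) p-e L else 0ₚ) (suc i)) pe ⟩
        (-Y ⊛ J (disjointᵇ d) p-e L) (suc i)
          ≡⟨ -Y⊛suc _ i ⟩
        ℤ.- J (disjointᵇ d) p-e L i
          ≡⟨ cong ℤ.-_ (J-coeff p-e L i) ⟩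
        ℤ.- (sign i ℤ.* + count (isMatching p-e i) (sublists L))
          ≡⟨ ℤP.neg-distribˡ-* (sign i) _ ⟩
        sign (suc i) ℤ.* + count (isMatching p-e i) (sublists L)
          ≡⟨ cong (λ x → sign (suc i) ℤ.* + x) (count-cong (λ M → sym (pred i M pe)) (sublists L)) ⟩
        sign (suc i) ℤ.* + count (isMatching p (suc i) ∘ (e ∷_)) (sublists L) ∎
      go false pe = begin
        with-e (suc i)
          ≡⟨ cong (λ b → (if b then -Y ⊛ J (disjointᵇ d) p-e L else 0ₚ) (suc i)) pe ⟩
        0ℤ
          ≡⟨ sym (ℤP.*-zeroʳ (sign (suc i))) ⟩
        sign (suc i) ℤ.* + 0
          ≡⟨ cong (λ x → sign (suc i) ℤ.* + x)
               (sym (trans (count-cong none (sublists L)) (count-false (sublists L)))) ⟩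
        sign (suc i) ℤ.* + count (isMatching p (suc i) ∘ (e ∷_)) (sublists L) ∎
        where
        none : ∀ M → isMatching p (suc i) (e ∷ M) ≡ false
        none M rewrite pe = trans (cong ((length M ≡ᵇ i) ∧_) (BP.∧-zeroʳ _)) (BP.∧-zeroʳ _)

matchingSeries : HGraph → Poly
matchingSeries G = J (disjointᵇ (decV G)) (λ _ → true) (edges G)

all-true : ∀ {A : Set} (L : List A) → all (λ _ → true) L ≡ true
all-true []      = refl
all-true (x ∷ L) = all-true L

matchingSeries-coeff : ∀ G i → matchingSeries G i ≡ sign i ℤ.* + numMatchings G i
matchingSeries-coeff G i = trans (J-coeff (decV G) (λ _ → true) (edges G) i)
  (cong (λ x → sign i ℤ.* + x) (count-cong
    (λ M → cong ((length M ≡ᵇ i) ∧_)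
      (trans (cong (pwDisjointᵇ (decV G) M ∧_) (all-true M)) (BP.∧-identityʳ _)))
    (sublists (edges G))))

∈-sublists : ∀ {A : Set} {x : A} {M} L → M ∈ sublists L → x ∈ M → x ∈ L
∈-sublists []      (here refl) ()
∈-sublists (y ∷ L) M∈ x∈ with ∈-++⁻ (map (y ∷_) (sublists L)) M∈
... | inj₂ M∈′ = there (∈-sublists L M∈′ x∈)
... | inj₁ M∈′ with ∈-map⁻ (y ∷_) M∈′
...   | M′ , M′∈ , refl with x∈
...     | here refl = here refl
...     | there x∈′ = there (∈-sublists L M′∈ x∈′)

count-none : ∀ {A : Set} (q : A → Bool) L → (∀ x → x ∈ L → q x ≡ true → ⊥) → count q L ≡ 0
count-none q []      h = refl
count-none q (x ∷ L) h with q x in e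
... | true  = ⊥-elim (h x (here refl) e)
... | false = count-none q L λ y y∈ → h y (there y∈)

-- Degree bounds for uniform hypergraphs

record Uniform (k : ℕ) (G : HGraph) : Set where
  field
    edge-unique : ∀ e → e ∈ edges G → Unique e
    edge-length : ∀ e → e ∈ edges G → length e ≡ k
    edge-verts  : ∀ e → e ∈ edges G → ∀ {x} → x ∈ e → x ∈ verts G

module _ {k : ℕ} {G : HGraph} (u : Uniform k G) where
  open Uniform u

  deleteV-uniform : ∀ x → Uniform k (deleteV G x)
  deleteV-uniform x = record
    { edge-unique = λ e e∈ → edge-unique e (proj₁ (old e∈))
    ; edge-length = λ e e∈ → edge-length e (proj₁ (old e∈))
    ; edge-verts  = λ e e∈ y∈ → ∈-remove⁺ (decV G)
        (λ { refl → ¬memᵇ⁻ (decV G) x e (proj₂ (old e∈)) y∈ })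
        (edge-verts e (proj₁ (old e∈)) y∈)
    }
    where
    old : ∀ {e} → e ∈ edges (deleteV G x) → e ∈ edges G × not (memᵇ (decV G) x e) ≡ true
    old = ∈-filterᵇ⁻ _ (edges G)

  concat-unique : ∀ M → (∀ e → e ∈ M → e ∈ edges G) → pwDisjointᵇ (decV G) M ≡ true →
    Unique (concat M)
  concat-unique []      h e = []
  concat-unique (x ∷ M) h e = UP.++⁺ (edge-unique x (h x (here refl)))
    (concat-unique M (λ y y∈ → h y (there y∈)) (proj₂ (∧-true {all (disjointᵇ (decV G) x) M} e)))
    λ (y∈x , y∈M) → let f , y∈f , f∈M = ∈-concat⁻′ M y∈M in
      disjointᵇ⁻ (decV G) x f (all⁻ _ M (proj₁ (∧-true e)) f f∈M) y∈x y∈f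

  length-concat : ∀ M → (∀ e → e ∈ M → e ∈ edges G) → length (concat M) ≡ length M ℕ.* k
  length-concat []      h = refl
  length-concat (x ∷ M) h = trans (LP.length-++ x)
    (cong₂ ℕ._+_ (edge-length x (h x (here refl))) (length-concat M λ y y∈ → h y (there y∈)))

  -- The edges of a matching of size i concatenate to a duplicate-free list of k i vertices, which
  -- cannot exceed the vertex list. So there is no such matching once k i is too large.
  matchingSeries-bounded : .{{_ : NonZero k}} → Reversal.Bounded k (length (verts G)) (matchingSeries G)
  matchingSeries-bounded i N<ki = trans (J-coeff (decV G) (λ _ → true) (edges G) i)
    (trans (cong (λ x → sign i ℤ.* + x) (count-none _ (sublists (edges G)) none))
           (ℤP.*-zeroʳ (sign i)))
    where
    none : ∀ M → M ∈ sublists (edges G) → isMatching (decV G) (λ _ → true) i M ≡ true → ⊥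
    none M M∈ e = ℕP.<⇒≱ N<ki (ℕP.≤-trans
      (ℕP.≤-reflexive (trans (ℕP.*-comm k i) (trans (cong (ℕ._* k) (sym |M|≡i)) (sym (length-concat M M⊆)))))
      (unique⊆⇒length≤ (decV G) (verts G)
        (concat-unique M M⊆ (proj₁ (∧-true {pwDisjointᵇ (decV G) M} (proj₂ (∧-true {length M ≡ᵇ i} e)))))
        λ x∈ → let f , x∈f , f∈M = ∈-concat⁻′ M x∈ in edge-verts f (M⊆ f f∈M) x∈f))
      where
      M⊆ : ∀ f → f ∈ M → f ∈ edges G
      M⊆ f = ∈-sublists (edges G) M∈
      |M|≡i : length M ≡ i
      |M|≡i = ℕP.≡ᵇ⇒≡ (length M) i (subst Bool.T (sym (proj₁ (∧-true e))) _)

-- Edge lists as filtered products, and vertices in rank order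

length-subsetToList : ∀ {n} (e : Subset n) → length (subsetToList e) ≡ ∣ e ∣
length-subsetToList Vec.[] = refl
length-subsetToList {suc n} (b Vec.∷ e) = split b
  where
  tail : ∀ b → count (λ u → does (u ∈? (b Vec.∷ e))) (tabulate Fin.suc) ≡ ∣ e ∣
  tail b = trans (cong (count member) (sym (LP.map-tabulate id Fin.suc)))
    (trans (count-map member Fin.suc (allFin n)) (length-subsetToList e))
    where
    member : Fin (suc n) → Bool
    member u = does (u ∈? (b Vec.∷ e))
  split : ∀ b → length (subsetToList (b Vec.∷ e)) ≡ ∣ b Vec.∷ e ∣
  split true  = cong suc (tail true)
  split false = tail false

concatMap-if : ∀ {A B : Set} (q : A → Bool) (g : A → B) (f : A → List B) →
  (∀ x → f x ≡ (if q x then [ g x ] else [])) → ∀ L → concatMap f L ≡ map g (filterᵇ q L)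
concatMap-if q g f h [] = refl
concatMap-if q g f h (x ∷ L) rewrite h x with q x
... | true  = cong (g x ∷_) (concatMap-if q g f h L)
... | false = concatMap-if q g f h L

-- Rewrites the nested edge list of the walk tree as the image of one filtered list of pairs, whose
-- freedom from duplicates is inherited from the two factors.
concatMap-product : ∀ {A B C : Set} (q : A × B → Bool) (g : A × B → C) (f : A → B → List C) →
  (∀ x y → f x y ≡ (if q (x , y) then [ g (x , y) ] else [])) → ∀ xs ys →
  concatMap (λ x → concatMap (f x) ys) xs ≡ map g (filterᵇ q (cartesianProduct xs ys))
concatMap-product q g f h []       ys = refl
concatMap-product q g f h (x ∷ xs) ys = begin
  concatMap (f x) ys ++ concatMap (λ x → concatMap (f x) ys) xs
    ≡⟨ cong₂ _++_ (trans (concatMap-if (q ∘ (x ,_)) (g ∘ (x ,_)) (f x) (h x) ys) (row ys))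
         (concatMap-product q g f h xs ys) ⟩
  map g (filterᵇ q (map (x ,_) ys)) ++ map g (filterᵇ q (cartesianProduct xs ys))
    ≡⟨ sym (LP.map-++ g (filterᵇ q (map (x ,_) ys)) _) ⟩
  map g (filterᵇ q (map (x ,_) ys) ++ filterᵇ q (cartesianProduct xs ys))
    ≡⟨ cong (map g) (sym (LP.filter-++ (λ z → BP.T? (q z)) (map (x ,_) ys) _)) ⟩
  map g (filterᵇ q (cartesianProduct (x ∷ xs) ys)) ∎
  where
  row : ∀ ys → map (g ∘ (x ,_)) (filterᵇ (q ∘ (x ,_)) ys) ≡ map g (filterᵇ q (map (x ,_) ys))
  row [] = refl
  row (y ∷ ys) with q (x , y)
  ... | true  = cong (g (x , y) ∷_) (row ys)
  ... | false = row ys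

unique⇔⇒↭ : ∀ {A : Set} {xs ys : List A} → Unique xs → Unique ys →
  (∀ {x} → x ∈ xs → x ∈ ys) → (∀ {x} → x ∈ ys → x ∈ xs) → xs ↭ ys
unique⇔⇒↭ u u′ f g = ∼bag⇒↭ (unique∧set⇒bag u u′ (mk⇔ f g))

module RankOrder {n : ℕ} (rank : Fin n → ℕ) (inj : Injective _≡_ _≡_ rank) where

  rankOrder = On.decTotalOrder ℕP.≤-decTotalOrder rank

  order : List (Fin n)
  order = Sort.sort rankOrder (allFin n)

  order-complete : ∀ u → u ∈ order
  order-complete u = ∈-resp-↭ (↭-sym (Sort.sort-↭ rankOrder (allFin n))) (∈-allFin u)

  -- Sorting yields only a weak order; the absence of repeated vertices and the injectivity of
  -- `rank` make it strict, as `telescope` requires.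
  order-sorted : AllPairs (λ x y → rank x < rank y) order
  order-sorted = AllPairs.zipWith (λ (le , ne) → ℕP.≤∧≢⇒< le (ne ∘ inj))
    ( Sorted.Sorted⇒AllPairs (On.totalOrder ℕP.≤-totalOrder rank) (Sort.sort-↗ rankOrder (allFin n))
    , PermSetoid.Unique-resp-↭ (≡.setoid (Fin n))
        (↭⇒↭ₛ (↭-sym (Sort.sort-↭ rankOrder (allFin n)))) (UP.allFin⁺ n))

-- Conflict-free walks in recursive form

module Walks {n : ℕ} (E : List (Subset n)) (rank : Fin n → ℕ) (order : List (Fin n)) where
  open Tree E rank order

  -- Only consecutive vertices are asked to differ. The other distinctness conditions of a
  -- Berge-path are consequences of avoiding the forbidden sets.
  Path : Subset n → Fin n → Walk n → Set
  Path C v []            = ⊤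
  Path C v ((e , u) ∷ W) =
    (e ∈ E × admissible v C e ≡ true) × (u Sub.∈ e × v ≢ u) × Path (C ∪ Cset rank v e u) u W

  extends⇒path : ∀ {C v f} W → Extends C v W f → Path C v W
  extends⇒path []      x           = tt
  extends⇒path (_ ∷ W) (p , q , x) = p , q , extends⇒path W x

  extends⇒path-∷ʳ : ∀ {C v f u} W → Extends C v W f → u Sub.∈ f → endV v W ≢ u →
    Path C v (W ++ [ (f , u) ])
  extends⇒path-∷ʳ []      x           u∈ end≢ = x , (u∈ , end≢) , tt
  extends⇒path-∷ʳ (_ ∷ W) (p , q , x) u∈ end≢ = p , q , extends⇒path-∷ʳ W x u∈ end≢

  path-∷ʳ⇒extends : ∀ {C v f u} W → Path C v (W ++ [ (f , u) ]) → Extends C v W f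
  path-∷ʳ⇒extends []      (x , _)     = x
  path-∷ʳ⇒extends (_ ∷ W) (p , q , x) = p , q , path-∷ʳ⇒extends W x

  extends-edge : ∀ {C v f} W → Extends C v W f → f ∈ E × endV v W Sub.∈ f
  extends-edge {C} {v} {f} [] (f∈ , a) = f∈ , proj₁ (admissible⁻ v C f a)
  extends-edge (_ ∷ W) (_ , _ , x) = extends-edge W x

  path-avoids : ∀ {C v} W → Path C v W → ∀ {e u} → (e , u) ∈ W →
    u Sub.∈ e × (∀ {x} → x Sub.∈ C → x Sub.∈ e → ⊥)
  path-avoids {C} {v} ((e , u) ∷ W) ((_ , a) , (u∈ , _) , _) (here refl) =
    u∈ , proj₂ (admissible⁻ v C e a)
  path-avoids ((e , u) ∷ W) (_ , _ , p) (there s∈) =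
    let u∈ , C# = path-avoids W p s∈ in u∈ , λ x∈C → C# (SP.p⊆p∪q _ x∈C)

  previous∈ : ∀ C v (e : Subset n) u → v Sub.∈ (C ∪ Cset rank v e u)
  previous∈ C v e u = SP.q⊆p∪q C _ (∈-Cset⁺ʳ rank {e = e} {u = u})

  -- The first step forbids v, and every vertex after u lies in a later edge, which avoids v.
  path⇒unique-vertices : ∀ {C v} W → Path C v W → Unique (v ∷ map proj₂ W)
  path⇒unique-vertices [] _ = [] ∷ []
  path⇒unique-vertices {C} {v} ((e , u) ∷ W) (_ , (_ , v≢u) , p) =
    (v≢u ∷ All.tabulate later) ∷ path⇒unique-vertices W p
    where
    later : ∀ {x} → x ∈ map proj₂ W → v ≢ x
    later x∈ refl with ∈-map⁻ proj₂ x∈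
    ... | _ , s∈ , refl = let x∈e , C# = path-avoids W p s∈ in C# (previous∈ C v e u) x∈e

  -- The edge e contains v, whereas all later edges avoid v.
  path⇒unique-edges : ∀ {C v} W → Path C v W → Unique (map proj₁ W)
  path⇒unique-edges [] _ = []
  path⇒unique-edges {C} {v} ((e , u) ∷ W) ((_ , a) , _ , p) =
    All.tabulate later ∷ path⇒unique-edges W p
    where
    later : ∀ {f} → f ∈ map proj₁ W → e ≢ f
    later f∈ refl with ∈-map⁻ proj₁ f∈
    ... | _ , s∈ , refl = proj₂ (path-avoids W p s∈) (previous∈ C v e u) (proj₁ (admissible⁻ v C e a))

  path⇒steps : ∀ {C v} W → Path C v W → Steps E rank v C W
  path⇒steps [] _ = tt
  path⇒steps {C} {v} ((e , u) ∷ W) ((e∈ , a) , (u∈ , _) , p) =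
    let v∈ , C# = admissible⁻ v C e a
    in e∈ , v∈ , u∈ , (λ w w∈e w∈C → C# w∈C w∈e) , path⇒steps W p

  steps⇒path : ∀ {C v} W → Unique (v ∷ map proj₂ W) → Steps E rank v C W → Path C v W
  steps⇒path [] _ _ = tt
  steps⇒path {C} {v} ((e , u) ∷ W) ((v≢u ∷ _) ∷ unique) (e∈ , v∈ , u∈ , e#C , s) =
    (e∈ , cong₂ _∧_ (does⁺ (v ∈? e) v∈) (dis⁺ C e λ x∈C x∈e → e#C _ x∈e x∈C)) ,
    (u∈ , v≢u) , steps⇒path W unique s

  path⇒cfwalk : ∀ {v} W → Path Sub.⊥ v W → CFWalk E rank v W
  path⇒cfwalk W p = path⇒unique-vertices W p , path⇒unique-edges W p , path⇒steps W p

  cfwalk⇒path : ∀ {v} W → CFWalk E rank v W → Path Sub.⊥ v W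
  cfwalk⇒path W (u , _ , s) = steps⇒path W u s

-- The walk tree of the definition, and the polynomial identity

toHGraph-uniform : ∀ {k n} (E : List (Subset n)) → (∀ e → e ∈ E → ∣ e ∣ ≡ k) → Uniform k (toHGraph n E)
toHGraph-uniform E sizes = record
  { edge-unique = λ f f∈ → unique (∈-map⁻ subsetToList f∈)
  ; edge-length = λ f f∈ → size (∈-map⁻ subsetToList f∈)
  ; edge-verts  = λ f f∈ {x} x∈ → ∈-allFin x
  }
  where
  unique : ∀ {f} → ∃ (λ e → e ∈ E × f ≡ subsetToList e) → Unique f
  unique (e , _ , refl) = subsetToList-unique e
  size : ∀ {f} → ∃ (λ e → e ∈ E × f ≡ subsetToList e) → length f ≡ _
  size (e , e∈ , refl) = trans (length-subsetToList e) (sizes e e∈)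

module WalkTree {k n : ℕ} (2≤k : 2 ≤ k) (E : List (Subset n)) (uE : Unique E)
  (sizes : ∀ e → e ∈ E → ∣ e ∣ ≡ k) (rank : Fin n → ℕ) (inj : Injective _≡_ _≡_ rank)
  (v : Fin n) (TV : List (Walk n)) (uTV : Unique TV)
  (TV⇔ : ∀ W → (W ∈ TV) ⇔ CFWalk E rank v W) where

  open RankOrder rank inj
  open Tree E rank order
  open Walks E rank order
  open Identity Series -Y uE order-sorted

  H T : HGraph
  H = toHGraph n E
  T = walkTree E TV v

  -- Spelled exactly like the test in `walkTree`, so that `edges-T` needs only `refl` for each pair.
  spans : Item n → Bool
  spans (W , e) = does (endV v W ∈? e) ∧ all (λ W′ → memᵇ decWalk W′ TV)
    (map (λ u → W ++ [ (e , u) ]) (remove decFin (endV v W) (subsetToList e)))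

  items : List (Item n)
  items = filterᵇ spans (cartesianProduct TV E)

  edges-T : edges T ≡ map (hyperedge v) items
  edges-T = concatMap-product spans (hyperedge v) _ (λ W e → refl) TV E

  ends : Item n → List (Fin n)
  ends (W , e) = remove decFin (endV v W) (subsetToList e)

  length-ends : ∀ {W e} → e ∈ E → endV v W Sub.∈ e → suc (length (ends (W , e))) ≡ k
  length-ends {W} {e} e∈ end∈ = trans
    (length-remove decFin (subsetToList e) (subsetToList-unique e) (∈-subsetToList⁺ end∈))
    (trans (length-subsetToList e) (sizes e e∈))

  record InItems (W : Walk n) (e : Subset n) : Set where
    constructor inItems
    field
      walk∈ : W ∈ TV
      edge∈ : e ∈ E
      end∈  : endV v W Sub.∈ e
      ext∈  : ∀ {u} → u ∈ ends (W , e) → (W ++ [ (e , u) ]) ∈ TV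

  items⁻ : ∀ {W e} → (W , e) ∈ items → InItems W e
  items⁻ {W} {e} i∈ =
    let i∈′ , s = ∈-filterᵇ⁻ spans (cartesianProduct TV E) i∈
        W∈ , e∈ = ∈-cartesianProduct⁻ TV E i∈′
        a , b = ∧-true {does (endV v W ∈? e)} s
    in inItems W∈ e∈ (does⁻ (endV v W ∈? e) a) λ u∈ →
         memᵇ⁻ decWalk _ TV (all⁻ _ _ b _ (∈-map⁺ (λ u → W ++ [ (e , u) ]) u∈))

  items⁺ : ∀ {W e} → InItems W e → (W , e) ∈ items
  items⁺ {W} {e} (inItems W∈ e∈ end∈ ext∈) = ∈-filterᵇ⁺ spans (∈-cartesianProduct⁺ W∈ e∈)
    (cong₂ _∧_ (does⁺ (endV v W ∈? e) end∈) (all⁺ _ _ λ W′ W′∈ →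
      memᵇ⁺ decWalk W′ TV (member (∈-map⁻ _ W′∈))))
    where
    member : ∀ {W′} → ∃ (λ u → u ∈ ends (W , e) × W′ ≡ W ++ [ (e , u) ]) → W′ ∈ TV
    member (u , u∈ , refl) = ext∈ u∈

  some-end : ∀ {W e} → e ∈ E → endV v W Sub.∈ e → ∃ λ u → u ∈ ends (W , e)
  some-end {W} {e} e∈ end∈ with ends (W , e) | length-ends {W} e∈ end∈
  ... | []    | refl = ⊥-elim (ℕP.<-irrefl refl 2≤k)
  ... | u ∷ _ | _    = u , here refl

  initial∉ : ¬ v Sub.∈ Sub.⊥
  initial∉ = SP.∉⊥

  fuel : n ≤ n ℕ.+ ∣ Sub.⊥ {n} ∣
  fuel = ℕP.m≤m+n n _

  items⇒tree : ∀ {i} → i ∈ items → i ∈ tree n v Sub.⊥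
  items⇒tree {W , e} i∈ = tree⁺ order-complete n W initial∉ fuel
    -- The test behind `items` does not compare e with the forbidden set. One extension of W by e,
    -- available because k ≥ 2, is a conflict-free walk whose last step shows that e is admissible.
    (path-∷ʳ⇒extends W (cfwalk⇒path _ (Equivalence.to (TV⇔ _)
      (ext∈ (proj₂ (some-end {W} edge∈ end∈))))))
    where open InItems (items⁻ i∈)

  -- Admissibility concerns e alone and not the vertex entered next, so all extensions of W by e are
  -- conflict-free at once and the hyperedge is complete.
  tree⇒items : ∀ {i} → i ∈ tree n v Sub.⊥ → i ∈ items
  tree⇒items {W , e} i∈ = items⁺ (inItems
    (Equivalence.from (TV⇔ W) (path⇒cfwalk W (extends⇒path W x)))
    (proj₁ (extends-edge W x)) (proj₂ (extends-edge W x))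
    λ u∈ → let u∈e , end≢ = ∈-remove⁻ decFin (subsetToList e) u∈ in
      Equivalence.from (TV⇔ _) (path⇒cfwalk _ (extends⇒path-∷ʳ W x (∈-subsetToList⁻ {e = e} u∈e) end≢)))
    where
    x : Extends Sub.⊥ v W e
    x = tree⁻ n i∈

  items↭tree : items ↭ tree n v Sub.⊥
  items↭tree = unique⇔⇒↭ (filterᵇ-unique spans (UP.cartesianProduct⁺ uTV uE))
    (tree-unique uE order-unique n v Sub.⊥) items⇒tree tree⇒items

  T-uniform : Uniform k T
  T-uniform = record
    { edge-unique = λ f f∈ → unique (edge f∈)
    ; edge-length = λ f f∈ → size (edge f∈)
    ; edge-verts  = λ f f∈ → vertex (edge f∈)
    }
    where
    Edge : List (Walk n) → Set
    Edge f = ∃ λ i → i ∈ items × f ≡ hyperedge v i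
    edge : ∀ {f} → f ∈ edges T → Edge f
    edge {f} f∈ = ∈-map⁻ (hyperedge v) (subst (f ∈_) edges-T f∈)
    unique : ∀ {f} → Edge f → Unique f
    unique ((W , e) , i∈ , refl) =
      All.tabulate (λ W′∈ p → longer (∈-map⁻ _ W′∈) p)
      ∷ UP.map⁺ (λ p → last-injective (LP.++-cancelˡ W _ _ p)) (filterᵇ-unique _ (subsetToList-unique e))
      where
      longer : ∀ {W′} → ∃ (λ u → u ∈ ends (W , e) × W′ ≡ W ++ [ (e , u) ]) → W ≡ W′ → ⊥
      longer (u , _ , refl) p with LP.++-identityʳ-unique W p
      ... | ()
      last-injective : ∀ {u u′ : Fin n} → [ (e , u) ] ≡ [ (e , u′) ] → u ≡ u′
      last-injective refl = refl
    size : ∀ {f} → Edge f → length f ≡ k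
    size ((W , e) , i∈ , refl) =
      trans (cong suc (LP.length-map _ (ends (W , e)))) (length-ends {W} edge∈ end∈)
      where open InItems (items⁻ i∈)
    vertex : ∀ {f} → Edge f → ∀ {x} → x ∈ f → x ∈ TV
    vertex ((W , e) , i∈ , refl) (here refl) = InItems.walk∈ (items⁻ i∈)
    vertex ((W , e) , i∈ , refl) (there x∈) with ∈-map⁻ _ x∈
    ... | u , u∈ , refl = InItems.ext∈ (items⁻ i∈) u∈

  module S = CommutativeSemiring Series

  H-series : matchingSeries H ≗ₚ h Sub.⊥
  H-series = S.trans {matchingSeries H}
    (J-map {d = dis} subsetToList E λ _ _ _ _ → refl)
    (J-cong E λ e _ → sym (dis⁺ Sub.⊥ e λ x∈ _ → SP.∉⊥ x∈))

  H-v-series : matchingSeries (deleteV H v) ≗ₚ h (Sub.⊥ ∪ ⁅ v ⁆)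
  H-v-series = S.trans {matchingSeries (deleteV H v)} (J-filter _ (map subsetToList E))
    (S.trans (J-map {d = dis} subsetToList E λ _ _ _ _ → refl)
      (J-cong E λ e _ → trans (BP.∧-identityʳ _) (avoid e)))
    where
    avoid : ∀ e → not (memᵇ decFin v (subsetToList e)) ≡ dis (Sub.⊥ ∪ ⁅ v ⁆) e
    avoid e = trans (⇔⇒≡
      (λ m → not-does⁺ (v ∈? e) λ v∈ → ¬memᵇ⁻ decFin v (subsetToList e) m (∈-subsetToList⁺ v∈))
      (λ m → ¬memᵇ⁺ decFin v (subsetToList e) λ v∈ → not-does⁻ (v ∈? e) m (∈-subsetToList⁻ {e = e} v∈)))
      (sym (trans (cong (λ C → dis C e) (SP.∪-identityˡ ⁅ v ⁆)) (dis-⁅⁆ v e)))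

  T-series : matchingSeries T ≗ₚ t n v Sub.⊥
  T-series rewrite edges-T = S.trans (J-map {d = tc v} (hyperedge v) items λ _ _ _ _ → refl)
    (J-↭ (tc-sym v) items↭tree)

  T-root-series : matchingSeries (deleteV T []) ≗ₚ t° n v Sub.⊥
  T-root-series rewrite edges-T = S.trans (J-filter _ (map (hyperedge v) items))
    (S.trans (J-map {d = tc v} (hyperedge v) items λ _ _ _ _ → refl)
    (S.trans (J-cong items λ i _ → trans (BP.∧-identityʳ _) (root i))
      (J-↭ (tc-sym v) items↭tree)))
    where
    root : ∀ i → not (memᵇ decWalk [] (hyperedge v i)) ≡ deep i
    root ([]    , e) = refl
    root (s ∷ W , e) = ¬memᵇ⁺ decWalk [] (hyperedge v (s ∷ W , e)) λ []∈ → nonempty []∈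
      where
      nonempty : [] ∈ hyperedge v (s ∷ W , e) → ⊥
      nonempty (there []∈) with ∈-map⁻ _ []∈
      ... | _ , _ , ()

  series-identity : matchingSeries (deleteV H v) ⊛ matchingSeries T
                 ≗ₚ matchingSeries (deleteV T []) ⊛ matchingSeries H
  series-identity = S.trans (⊛-cong H-v-series T-series)
    (S.trans (⊛-comm (h (Sub.⊥ ∪ ⁅ v ⁆)) (t n v Sub.⊥))
    (S.trans (tree-identity order-complete n v Sub.⊥ initial∉ fuel)
      (S.sym (⊛-cong T-root-series H-series))))

  instance
    k≢0 : ℕ.NonZero k
    k≢0 = ℕ.>-nonZero (ℕP.≤-trans (s≤s z≤n) 2≤k)

  open Reversal k

  matchingPoly≗rev : ∀ G → matchingPoly k G ≗ₚ rev (length (verts G)) (matchingSeries G)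
  matchingPoly≗rev G = rev-cong (length (verts G)) λ i → sym (matchingSeries-coeff G i)

  -- Each side misses one vertex, v on the left and the root on the right. Both products are
  -- therefore reversed at the same exponent, and the series identity carries over.
  degrees : length (verts (deleteV H v)) ℕ.+ length (verts T)
          ≡ length (verts (deleteV T [])) ℕ.+ length (verts H)
  degrees = ℕP.suc-injective (begin
    suc (length (remove decFin v (allFin n)) ℕ.+ length TV)
      ≡⟨ cong₂ ℕ._+_ (length-remove decFin (allFin n) (UP.allFin⁺ n) (∈-allFin v))
           (sym (length-remove decWalk TV uTV (Equivalence.from (TV⇔ []) (path⇒cfwalk [] tt)))) ⟩
    length (allFin n) ℕ.+ suc (length (remove decWalk [] TV))
      ≡⟨ ℕP.+-comm (length (allFin n)) _ ⟩
    suc (length (remove decWalk [] TV) ℕ.+ length (allFin n)) ∎)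

  matchingPoly-⊛ : ∀ {G G′} → Uniform k G → Uniform k G′ →
    matchingPoly k G *ₚ matchingPoly k G′
      ≗ₚ rev (length (verts G) ℕ.+ length (verts G′)) (matchingSeries G ⊛ matchingSeries G′)
  matchingPoly-⊛ {G} {G′} u u′ = S.trans (*ₚ≗⊛ (matchingPoly k G) (matchingPoly k G′))
    (S.trans (⊛-cong (matchingPoly≗rev G) (matchingPoly≗rev G′))
      (rev-⊛ (matchingSeries-bounded u) (matchingSeries-bounded u′)))

  H-uniform : Uniform k H
  H-uniform = toHGraph-uniform E sizes

  polynomial-identity : matchingPoly k (deleteV H v) *ₚ matchingPoly k T
                     ≗ₚ matchingPoly k (deleteV T []) *ₚ matchingPoly k H
  polynomial-identity = S.trans (matchingPoly-⊛ (deleteV-uniform H-uniform v) T-uniform)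
    (S.trans (S.trans (rev-cong (length (verts (deleteV H v)) ℕ.+ length (verts T)) series-identity)
      (S.reflexive (cong (λ N → rev N (matchingSeries (deleteV T []) ⊛ matchingSeries H)) degrees)))
      (S.sym (matchingPoly-⊛ (deleteV-uniform T-uniform []) H-uniform)))

theorem3p5 : (k n : ℕ) → 2 ≤ k
    → (E : List (Subset n)) → Unique E → (∀ e → e ∈ E → ∣ e ∣ ≡ k)
    → (rank : Fin n → ℕ) → Injective _≡_ _≡_ rank
    → (v : Fin n)
    → (TV : List (Walk n)) → Unique TV → (∀ W → (W ∈ TV) ⇔ CFWalk E rank v W)
    → ∀ j → (matchingPoly k (deleteV (toHGraph n E) v) *ₚ matchingPoly k (walkTree E TV v)) j
    ≡ (matchingPoly k (deleteV (walkTree E TV v) []) *ₚ matchingPoly k (toHGraph n E)) j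
theorem3p5 k n 2≤k E uE sizes rank inj v TV uTV TV⇔ =
  WalkTree.polynomial-identity 2≤k E uE sizes rank inj v TV uTV TV⇔
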